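{- Let $(W,S)$ be a Coxeter system, let $I,J\subset S$ be finitary, and let $p$ be a core $(I,J)$-coset. Then $p$ has a reduced atomic expression, i.e. a reduced expression which is a composition (concatenation) of reduced expressions $[[I_{i-1}\subset M_i\supset I_i]]$ of atomic cosets.
   Context: Let $(W,S)$ be a Coxeter system with length function $\ell$. A subset $I\subset S$ is finitary if the parabolic subgroup $W_I$ is finite; then $w_I$ is the longest element of $W_I$ and $\ell(I):=\ell(w_I)$. For finitary $I,J$, an $(I,J)$-coset is an element $p\in W_I\backslash W/W_J$ (the pair $(I,J)$ is part of the data); it has a unique maximal element $\overline{p}$ and a unique minimal element $\underline{p}$ in the Bruhat order. The coset $p$ is a core coset if $I=\underline{p}\,J\,\underline{p}^{ -1}$ (as sets of simple reflections). A (multistep) $(I,J)$-expression is a sequence of finitary subsets $[[I=I_0\subset K_1\supset I_1\subset K_2\supset\cdots\subset K_m\supset I_m=J]]$ (equalities permitted). It is a reduced expression for $p$ if $\overline{p}=w_{K_1}w_{I_1}^{ -1}w_{K_2}w_{I_2}^{ -1}\cdots w_{I_{m-1}}^{ -1}w_{K_m}$ and $\ell(\overline{p})=\ell(K_1)-\ell(I_1)+\ell(K_2)-\cdots-\ell(I_{m-1})+\ell(K_m)$. Atomic coset: let $M\subset S$ be finitary, $s\in M$, $t=w_Msw_M$, $I=M\setminus\{s\}$, $J=M\setminus\{t\}$; the $(I,J)$-coset containing $w_M$ is called atomic, and its reduced expression is $[[I\subset M\supset J]]$. A reduced atomic expression for $p$ is a reduced expression $[[I=I_0\subset M_1\supset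 I_1\subset M_2\supset\cdots\subset M_k\supset I_k=J]]$ for $p$ such that each piece $[[I_{i-1}\subset M_i\supset I_i]]$ is the reduced expression of an atomic coset; the trivial expression $[I]$ (with $k=0$) is allowed, and is the reduced expression of the identity $(I,I)$-coset $W_I$. -}

module Defs where

open import Level using (Level; _⊔_) renaming (suc to lsuc)
open import Algebra.Bundles using (Group)
open import Data.Nat using (ℕ; _≤_; _<_)
open import Data.Nat.Divisibility using (_∣_)
open import Data.Integer using (ℤ; +_) renaming (_+_ to _+ℤ_; _-_ to _-ℤ_)
open import Data.List using (List; []; _∷_; _++_; concat; replicate; foldr; length)
open import Data.List.Extrema.Nat using (argmax)
open import Data.List.Relation.Unary.All using (All)
import Data.List.Membership.Setoid as SetoidMembership
open import Data.Product using (∃₂; ∃-syntax; _×_; _,_)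
open import Data.Unit.Polymorphic using (⊤)
open import Function.Bundles using (_⇔_)
open import Relation.Nullary using (¬_)
open import Relation.Unary using (Pred; _∈_; _⊆_; _≐_)
open import Relation.Binary.PropositionalEquality using (_≡_; _≢_)

power : ∀ {a} {S : Set a} → ℕ → List S → List S
power k u = concat (replicate k u)

-- The congruence on words generated by (st)^{m(s,t)} = 1.  The value m(s,t) = 0
-- stands for ∞ and imposes no relation.  When m(s,s) = 1 the relations include
-- ss = 1, so the monoid of words modulo this congruence is the group presented
-- by the same relations.
data _⊢_~_ {a} {S : Set a} (m : S → S → ℕ) : List S → List S → Set a where
  ~-refl  : ∀ {u} → m ⊢ u ~ u
  ~-sym   : ∀ {u v} → m ⊢ u ~ v → m ⊢ v ~ u
  ~-trans : ∀ {u v w} → m ⊢ u ~ v → m ⊢ v ~ w → m ⊢ u ~ w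
  ~-cong  : ∀ {u u′ v v′} → m ⊢ u ~ u′ → m ⊢ v ~ v′ → m ⊢ (u ++ v) ~ (u′ ++ v′)
  ~-rel   : ∀ s t → m ⊢ power (m s t) (s ∷ t ∷ []) ~ []

-- A Coxeter system in Bourbaki's sense: S is a generating set of elements of
-- order 2, and W is presented by the relations (st)^{m(s,t)} = 1, where m(s,t)
-- is the order of st (0 if the order is infinite).
record CoxeterSystem (a c r : Level) : Set (lsuc (a ⊔ c ⊔ r)) where
  field
    W : Group c r
    S : Set a
  open Group W public using (Carrier; _≈_; _∙_; ε; _⁻¹; setoid)
  field
    ι            : S → Carrier
    ι-injective  : ∀ {s t} → ι s ≈ ι t → s ≡ t
    ι-nontrivial : ∀ s → ¬ (ι s ≈ ε)
    ι-involutive : ∀ s → ι s ∙ ι s ≈ ε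

  ⟦_⟧ : List S → Carrier
  ⟦ u ⟧ = foldr (λ s w → ι s ∙ w) ε u

  field
    m            : S → S → ℕ
    m-order      : ∀ s t k → ⟦ power k (s ∷ t ∷ []) ⟧ ≈ ε ⇔ m s t ∣ k
    generates    : ∀ w → ∃[ u ] ⟦ u ⟧ ≈ w
    presentation : ∀ u v → ⟦ u ⟧ ≈ ⟦ v ⟧ ⇔ m ⊢ u ~ v

-- The length function is uniquely determined by this specification; it is given
-- as data because a minimum over all words for w is not computable outright.
record LengthFunction {a c r} (C : CoxeterSystem a c r) : Set (a ⊔ c ⊔ r) where
  open CoxeterSystem C
  field
    ℓ          : Carrier → ℕ
    ℓ-attained : ∀ w → ∃[ u ] (⟦ u ⟧ ≈ w × length u ≡ ℓ w)
    ℓ-minimal  : ∀ w u → ⟦ u ⟧ ≈ w → ℓ w ≤ length u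

module Coxeter {a c r} (C : CoxeterSystem a c r) (L : LengthFunction C) where
  open CoxeterSystem C
  open LengthFunction L
  open SetoidMembership setoid using () renaming (_∈_ to _∈ₗ_)

  -- W_I; inverses are not needed because the generators are involutions.
  Parabolic : Pred S a → Pred Carrier (a ⊔ r)
  Parabolic I w = ∃[ u ] (All I u × ⟦ u ⟧ ≈ w)

  record Finitary : Set (lsuc a ⊔ c ⊔ r) where
    field
      subset      : Pred S a
      elements    : List Carrier
      enumeration : ∀ w → (w ∈ Parabolic subset) ⇔ (w ∈ₗ elements)

    longest : Carrier
    longest = argmax ℓ ε elements

  open Finitary public using (subset)

  w[_] : Finitary → Carrier
  w[ I ] = Finitary.longest I

  ℓ[_] : Finitary → ℤ
  ℓ[ I ] = + ℓ w[ I ]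

  -- An element of W_I\W/W_J, given by any of its representatives.
  record DoubleCoset (I J : Finitary) : Set c where
    constructor coset-of
    field
      representative : Carrier

  ⟨_⟩ : ∀ {I J} → DoubleCoset I J → Pred Carrier (a ⊔ c ⊔ r)
  ⟨_⟩ {I} {J} p w = ∃₂ λ x y →
    x ∈ Parabolic (subset I) × y ∈ Parabolic (subset J) ×
    w ≈ (x ∙ DoubleCoset.representative p) ∙ y

  Reflection : Pred Carrier (a ⊔ c ⊔ r)
  Reflection t = ∃₂ λ x s → t ≈ (x ∙ ι s) ∙ x ⁻¹

  data _≤ᴮ_ : Carrier → Carrier → Set (a ⊔ c ⊔ r) where
    ≤ᴮ-refl : ∀ {x y} → x ≈ y → x ≤ᴮ y
    ≤ᴮ-step : ∀ {x y z} t → t ∈ Reflection → y ≈ x ∙ t → ℓ x < ℓ y →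
              y ≤ᴮ z → x ≤ᴮ z

  IsMaximum : ∀ {I J} → DoubleCoset I J → Pred Carrier (a ⊔ c ⊔ r)
  IsMaximum p x = x ∈ ⟨ p ⟩ × (∀ y → y ∈ ⟨ p ⟩ → y ≤ᴮ x)

  IsMinimum : ∀ {I J} → DoubleCoset I J → Pred Carrier (a ⊔ c ⊔ r)
  IsMinimum p x = x ∈ ⟨ p ⟩ × (∀ y → y ∈ ⟨ p ⟩ → x ≤ᴮ y)

  Simple : Pred S a → Pred Carrier (a ⊔ r)
  Simple I w = ∃[ s ] (s ∈ I × w ≈ ι s)

  Conjugate : ∀ {p} → Carrier → Pred Carrier p → Pred Carrier (c ⊔ r ⊔ p)
  Conjugate x P w = ∃[ v ] (v ∈ P × w ≈ (x ∙ v) ∙ x ⁻¹)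

  IsCore : ∀ {I J} → DoubleCoset I J → Set (a ⊔ c ⊔ r)
  IsCore {I} {J} p =
    ∃[ x ] (IsMinimum p x × Simple (subset I) ≐ Conjugate x (Simple (subset J)))

  -- [ I ] has I = J as sets; step K I₁ _ _ e is [[I ⊂ K ⊃ I₁]] followed by e.
  data Expression : Finitary → Finitary → Set (lsuc a ⊔ c ⊔ r) where
    trivial : ∀ {I J} → subset I ≐ subset J → Expression I J
    step    : ∀ {I J} K I₁ → subset I ⊆ subset K → subset I₁ ⊆ subset K →
              Expression I₁ J → Expression I J

  -- w_{K₁} w_{I₁}⁻¹ w_{K₂} ⋯ w_{I_{m-1}}⁻¹ w_{K_m}, read as w_I when m = 0.
  product : ∀ {I J} → Expression I J → Carrier
  product {I} (trivial _)                      = w[ I ]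
  product (step K I₁ _ _ (trivial _))          = w[ K ]
  product (step K I₁ _ _ e@(step _ _ _ _ _))   = (w[ K ] ∙ w[ I₁ ] ⁻¹) ∙ product e

  -- ℓ(K₁) - ℓ(I₁) + ℓ(K₂) - ⋯ - ℓ(I_{m-1}) + ℓ(K_m), read as ℓ(I) when m = 0.
  expressionLength : ∀ {I J} → Expression I J → ℤ
  expressionLength {I} (trivial _)                    = ℓ[ I ]
  expressionLength (step K I₁ _ _ (trivial _))        = ℓ[ K ]
  expressionLength (step K I₁ _ _ e@(step _ _ _ _ _)) =
    (ℓ[ K ] -ℤ ℓ[ I₁ ]) +ℤ expressionLength e

  IsReducedExpression : ∀ {I J} → Expression I J → DoubleCoset I J → Set (a ⊔ c ⊔ r)
  IsReducedExpression e p =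
    ∃[ x ] (IsMaximum p x × x ≈ product e × + ℓ x ≡ expressionLength e)

  _∖_ : Pred S a → S → Pred S a
  (M ∖ s) i = i ∈ M × i ≢ s

  -- p is the atomic coset attached to some s ∈ M, with t = w_M s w_M.
  record AtomicVia {I J : Finitary} (M : Finitary) (p : DoubleCoset I J) : Set (a ⊔ c ⊔ r) where
    field
      s t  : S
      s∈M  : s ∈ subset M
      t≈   : ι t ≈ (w[ M ] ∙ ι s) ∙ w[ M ]
      I≐   : subset I ≐ (subset M ∖ s)
      J≐   : subset J ≐ (subset M ∖ t)
      w∈p  : w[ M ] ∈ ⟨ p ⟩

  IsAtomicCoset : ∀ {I J} → DoubleCoset I J → Set (lsuc a ⊔ c ⊔ r)
  IsAtomicCoset p = ∃[ M ] AtomicVia M p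

  IsAtomicExpression : ∀ {I J} → Expression I J → Set (lsuc a ⊔ c ⊔ r)
  IsAtomicExpression (trivial _) = ⊤
  IsAtomicExpression {I} (step M I₁ I⊆M I₁⊆M e) =
    (∃[ q ] (IsAtomicCoset {I} {I₁} q ×
             IsReducedExpression (step M I₁ I⊆M I₁⊆M (trivial ((λ i → i) , (λ i → i)))) q))
    × IsAtomicExpression e

{-# OPTIONS --safe #-}

-- For t ∈ W, the number of i with t = s₁ ⋯ sᵢ₋₁ sᵢ sᵢ₋₁ ⋯ s₁ has the same parity for
-- all words s₁ ⋯ sₖ representing a given element; this gives the exchange condition.
--
-- Let x be the minimal element of a core (I,J)-coset and s a left descent of x, so that
-- s ∉ I.  Since w_I x = x w_J is length additive, M = I ∪ {s} consists of left descents
-- of g = w_I x.  By the exchange condition every element of W_M is then a prefix of g, so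
-- W_M is finite and g = w_M h with ℓ(g) = ℓ(w_M) + ℓ(h).  As conjugation by w_M and by
-- w_I permutes M and I, the element h = w_M w_I x is the minimal element of a core
-- (M ∖ t, J)-coset with t = w_M s w_M, and ℓ(h) < ℓ(x).  So [[I ⊂ M ⊃ M ∖ t]] followed by
-- a reduced atomic expression for the coset of h is the required expression.

module Submission where

open import Defs
open import Level using (_⊔_) renaming (suc to lsuc)
open import Algebra.Bundles using (Group)
import Algebra.Properties.Group as GroupProperties
import Algebra.Properties.Monoid as MonoidProperties
import Algebra.Properties.Monoid.Mult as MonoidMult
open import Data.Bool using (Bool; true; false; not; _xor_)
open import Data.Bool.Properties using (xor-assoc; xor-same; not-injective)
open import Data.Nat using (ℕ; zero; suc; _+_; _≤_; _<_; _<?_; z≤n; s≤s; s≤s⁻¹)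
import Data.Nat.Properties as ℕ
open import Data.Nat.Divisibility using (∣-refl)
open import Data.List using (List; []; _∷_; _++_; length; reverse; map; filter)
open import Data.List.Extrema.Nat using (argmax-sel; v≤f[argmax]⁺)
open import Data.List.Membership.Propositional using () renaming (_∈_ to _∈ₗ_)
open import Data.List.Membership.Propositional.Properties using (∈-map⁺)
open import Data.List.Membership.Setoid.Properties using (∈-filter⁺; ∈-filter⁻)
open import Data.List.Relation.Unary.Any as Any using (Any; here; any?)
import Data.List.Relation.Unary.Any.Properties as Any
import Data.List.Properties as List
open import Data.List.Relation.Unary.All as All using (All; []; _∷_)
import Data.List.Relation.Unary.All.Properties as All
open import Data.List.Relation.Binary.Sublist.Propositional.Properties using (All-resp-⊆)
open import Data.List.Relation.Binary.Sublist.Propositional using (_⊆_; []; _∷_; _∷ʳ_; ⊆-refl; ⊆-trans)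
open import Data.Product using (∃-syntax; _×_; _,_; proj₁; proj₂)
open import Data.Integer using (-_) renaming (+_ to pos; _+_ to _+ℤ_; _-_ to _-ℤ_)
import Data.Integer.Properties as ℤ
open import Data.Sum using (_⊎_; inj₁; inj₂)
open import Data.Unit.Polymorphic using (tt)
open import Function.Bundles using (_⇔_; mk⇔; module Equivalence)
open import Relation.Binary.PropositionalEquality as ≡ using (_≡_; _≢_)
import Relation.Binary.Reasoning.Setoid as ≈-Reasoning
open import Relation.Nullary using (¬_; Dec; yes; no; does; contradiction)
open import Relation.Nullary.Decidable using (map′; does-⇔; dec-true; _×-dec_; _⊎-dec_; ¬?)
open import Relation.Unary using (Pred; Decidable; _∈_; _≐_) renaming (_⊆_ to _⊆ᵖ_)
open import Tactic.MonoidSolver using (solve)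

-- Sublists of a list, and an integer identity.

sublists : ∀ {a} {A : Set a} → List A → List (List A)
sublists []       = [] ∷ []
sublists (x ∷ xs) = map (x ∷_) (sublists xs) ++ sublists xs

∈-sublists : ∀ {a} {A : Set a} {xs ys : List A} → xs ⊆ ys → xs ∈ₗ sublists ys
∈-sublists []             = here ≡.refl
∈-sublists (y ∷ʳ xs⊆ys)   = Any.++⁺ʳ _ (∈-sublists xs⊆ys)
∈-sublists (≡.refl ∷ xs⊆ys) = Any.++⁺ˡ (∈-map⁺ (_ ∷_) (∈-sublists xs⊆ys))

minus-plus : ∀ i j → (i -ℤ j) +ℤ j ≡ i
minus-plus i j = ≡.trans (ℤ.+-assoc i (- j) j)
  (≡.trans (≡.cong (i +ℤ_) (ℤ.+-inverseˡ j)) (ℤ.+-identityʳ i))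

module CoxeterTheory {a c r} (C : CoxeterSystem a c r) (L : LengthFunction C) where
  open CoxeterSystem C
  open LengthFunction L
  open Coxeter C L
  open Group W using (∙-cong; ∙-congˡ; ∙-congʳ; assoc; identityˡ; identityʳ;
    inverseˡ; inverseʳ; ⁻¹-cong; refl; sym; trans; reflexive; monoid)
  open GroupProperties W using (inverseˡ-unique; ⁻¹-anti-homo-∙;
    ⁻¹-involutive; ∙-cancelˡ; ∙-cancelʳ; x∙y⁻¹≈ε⇒x≈y; x≈y⇒x∙y⁻¹≈ε; ε⁻¹≈ε)
  open MonoidProperties monoid using (cancelˡ; cancelʳ; cancelᶜ)

  private variable
    w w′ x y z : Carrier
    u v : List S

  -- Length, words and decidable equality.

  ℓ-resp-≤ : x ≈ y → ℓ x ≤ ℓ y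
  ℓ-resp-≤ {x} {y} x≈y with u , u≈y , len ← ℓ-attained y =
    ≡.subst (ℓ x ≤_) len (ℓ-minimal x u (trans u≈y (sym x≈y)))

  ℓ-cong : x ≈ y → ℓ x ≡ ℓ y
  ℓ-cong x≈y = ℕ.≤-antisym (ℓ-resp-≤ x≈y) (ℓ-resp-≤ (sym x≈y))

  ℓ-⟦⟧ : ∀ u → ℓ ⟦ u ⟧ ≤ length u
  ℓ-⟦⟧ u = ℓ-minimal ⟦ u ⟧ u refl

  ℓ-ε : ℓ ε ≡ 0
  ℓ-ε = ℕ.n≤0⇒n≡0 (ℓ-⟦⟧ [])

  ℓ≡0⇒≈ε : ℓ x ≡ 0 → x ≈ ε
  ℓ≡0⇒≈ε {x} ℓx≡0 with ℓ-attained x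
  ... | []    , u≈x , _   = sym u≈x
  ... | _ ∷ _ , _   , len = contradiction (≡.trans len ℓx≡0) λ ()

  ⟦⟧-++ : ∀ u v → ⟦ u ++ v ⟧ ≈ ⟦ u ⟧ ∙ ⟦ v ⟧
  ⟦⟧-++ []      v = sym (identityˡ _)
  ⟦⟧-++ (s ∷ u) v = trans (∙-congˡ (⟦⟧-++ u v)) (sym (assoc _ _ _))

  ι⁻¹ : ∀ s → ι s ⁻¹ ≈ ι s
  ι⁻¹ s = sym (inverseˡ-unique _ _ (ι-involutive s))

  ιι-cancel : ∀ s x → ι s ∙ (ι s ∙ x) ≈ x
  ιι-cancel s = cancelˡ (ι-involutive s)

  ⟦⟧-reverse : ∀ u → ⟦ reverse u ⟧ ≈ ⟦ u ⟧ ⁻¹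
  ⟦⟧-reverse []      = sym ε⁻¹≈ε
  ⟦⟧-reverse (s ∷ u) = begin
    ⟦ reverse (s ∷ u) ⟧             ≡⟨ ≡.cong ⟦_⟧ (List.unfold-reverse s u) ⟩
    ⟦ reverse u ++ s ∷ [] ⟧         ≈⟨ ⟦⟧-++ (reverse u) (s ∷ []) ⟩
    ⟦ reverse u ⟧ ∙ (ι s ∙ ε)       ≈⟨ ∙-cong (⟦⟧-reverse u) (trans (identityʳ _) (sym (ι⁻¹ s))) ⟩
    ⟦ u ⟧ ⁻¹ ∙ ι s ⁻¹               ≈⟨ ⁻¹-anti-homo-∙ _ _ ⟨
    (ι s ∙ ⟦ u ⟧) ⁻¹                ∎
    where open ≈-Reasoning setoid

  ℓ-∙ : ∀ x y → ℓ (x ∙ y) ≤ ℓ x + ℓ y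
  ℓ-∙ x y with u , u≈x , lenu ← ℓ-attained x | v , v≈y , lenv ← ℓ-attained y =
    ≡.subst (ℓ (x ∙ y) ≤_) (≡.trans (List.length-++ u) (≡.cong₂ _+_ lenu lenv))
      (ℓ-minimal _ (u ++ v) (trans (⟦⟧-++ u v) (∙-cong u≈x v≈y)))

  ℓ-ι : ∀ s → ℓ (ι s) ≤ 1
  ℓ-ι s = ℓ-minimal _ (s ∷ []) (identityʳ _)

  ℓ-ι∙ : ∀ s x → ℓ (ι s ∙ x) ≤ suc (ℓ x)
  ℓ-ι∙ s x = ℕ.≤-trans (ℓ-∙ _ _) (ℕ.+-monoˡ-≤ _ (ℓ-ι s))

  ℓ-ι∙′ : ∀ s x → ℓ x ≤ suc (ℓ (ι s ∙ x))
  ℓ-ι∙′ s x = ℕ.≤-trans (ℓ-resp-≤ (sym (ιι-cancel s x))) (ℓ-ι∙ s _)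

  ℓ-⁻¹-≤ : ∀ x → ℓ (x ⁻¹) ≤ ℓ x
  ℓ-⁻¹-≤ x with u , u≈x , len ← ℓ-attained x =
    ≡.subst (ℓ (x ⁻¹) ≤_) (≡.trans (List.length-reverse u) len)
      (ℓ-minimal _ (reverse u) (trans (⟦⟧-reverse u) (⁻¹-cong u≈x)))

  ℓ-⁻¹ : ∀ x → ℓ (x ⁻¹) ≡ ℓ x
  ℓ-⁻¹ x = ℕ.≤-antisym (ℓ-⁻¹-≤ x)
    (ℕ.≤-trans (ℓ-resp-≤ (sym (⁻¹-involutive x))) (ℓ-⁻¹-≤ (x ⁻¹)))

  abstract
    -- Length zero characterises the identity, so comparing `ℓ (x ∙ y ⁻¹)` with 0 decides equality
    -- in `W`, and through `ι-injective` also in `S`.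
    _≟_ : ∀ x y → Dec (x ≈ y)
    x ≟ y = map′ (λ p → x∙y⁻¹≈ε⇒x≈y x y (ℓ≡0⇒≈ε p))
                 (λ p → ≡.trans (ℓ-cong (x≈y⇒x∙y⁻¹≈ε p)) ℓ-ε)
                 (ℓ (x ∙ y ⁻¹) ℕ.≟ 0)

  _≟ₛ_ : ∀ s t → Dec (s ≡ t)
  s ≟ₛ t = map′ ι-injective (λ { ≡.refl → refl }) (ι s ≟ ι t)

  -- Reflections read off a word, counted modulo 2.

  does-≟-cong : ∀ {x x′ y y′} → x ≈ x′ → y ≈ y′ → does (x ≟ y) ≡ does (x′ ≟ y′)
  does-≟-cong p q = does-⇔
    (mk⇔ (λ e → trans (sym p) (trans e q)) (λ e → trans p (trans e (sym q)))) (_ ≟ _) (_ ≟ _)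

  -- The parity of the number of i with t = s₁ ⋯ sᵢ₋₁ sᵢ sᵢ₋₁ ⋯ s₁, where u = s₁ ⋯ sₖ.
  parity : List S → Carrier → Bool
  parity []      t = false
  parity (s ∷ u) t = does (t ≟ ι s) xor parity u ((ι s ∙ t) ∙ ι s)

  parity-congʳ : ∀ u → x ≈ y → parity u x ≡ parity u y
  parity-congʳ []      p = ≡.refl
  parity-congʳ (s ∷ u) p =
    ≡.cong₂ _xor_ (does-≟-cong p refl) (parity-congʳ u (∙-congʳ (∙-congˡ p)))

  -- Inside `u ++ v` the reflections of `v` appear conjugated by `⟦ u ⟧`; undoing this conjugation
  -- on `t` recovers the count for `v` alone.
  parity-++ : ∀ u v t → parity (u ++ v) t ≡ parity u t xor parity v ((⟦ u ⟧ ⁻¹ ∙ t) ∙ ⟦ u ⟧)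
  parity-++ [] v t = parity-congʳ v (sym (trans (identityʳ _)
    (trans (∙-congʳ ε⁻¹≈ε) (identityˡ _))))
  parity-++ (s ∷ u) v t = ≡.trans
    (≡.cong (does (t ≟ ι s) xor_) (≡.trans (parity-++ u v _)
      (≡.cong (parity u ((ι s ∙ t) ∙ ι s) xor_) (parity-congʳ v eq))))
    (≡.sym (xor-assoc (does (t ≟ ι s)) _ _))
    where
    open ≈-Reasoning setoid
    eq : (⟦ u ⟧ ⁻¹ ∙ ((ι s ∙ t) ∙ ι s)) ∙ ⟦ u ⟧ ≈ ((ι s ∙ ⟦ u ⟧) ⁻¹ ∙ t) ∙ (ι s ∙ ⟦ u ⟧)
    eq = begin
      (⟦ u ⟧ ⁻¹ ∙ ((ι s ∙ t) ∙ ι s)) ∙ ⟦ u ⟧     ≈⟨ solve monoid ⟩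
      ((⟦ u ⟧ ⁻¹ ∙ ι s) ∙ t) ∙ (ι s ∙ ⟦ u ⟧)     ≈⟨ ∙-congʳ (∙-congʳ (∙-congˡ (ι⁻¹ s))) ⟨
      ((⟦ u ⟧ ⁻¹ ∙ ι s ⁻¹) ∙ t) ∙ (ι s ∙ ⟦ u ⟧)  ≈⟨ ∙-congʳ (∙-congʳ (⁻¹-anti-homo-∙ _ _)) ⟨
      ((ι s ∙ ⟦ u ⟧) ⁻¹ ∙ t) ∙ (ι s ∙ ⟦ u ⟧)     ∎

  conj-transpose : ∀ s → (ι s ∙ x) ∙ ι s ≈ y → x ≈ (ι s ∙ y) ∙ ι s
  conj-transpose {x} {y} s p = begin
    x                              ≈⟨ cancelʳ (ι-involutive s) x ⟨
    (x ∙ ι s) ∙ ι s                ≈⟨ ∙-congʳ (ιι-cancel s _) ⟨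
    (ι s ∙ (ι s ∙ (x ∙ ι s))) ∙ ι s ≈⟨ ∙-congʳ (∙-congˡ (assoc _ _ _)) ⟨
    (ι s ∙ ((ι s ∙ x) ∙ ι s)) ∙ ι s ≈⟨ ∙-congʳ (∙-congˡ p) ⟩
    (ι s ∙ y) ∙ ι s                ∎
    where open ≈-Reasoning setoid

  -- The reflections read off the word (st)ᵏ are (st)ʲ s for j < 2k; for k = m(s,t)
  -- they repeat with period k, so each occurs an even number of times.
  module _ (s t : S) where
    open MonoidMult monoid using (×-homo-+; ×-homo-1) renaming (_×_ to _·_)
    open ≈-Reasoning setoid

    private
      st : Carrier
      st = ι s ∙ ι t

    alternating : ℕ → ℕ → Carrier → Bool
    alternating zero    j x = false
    alternating (suc n) j x = does (x ≟ ((j · st) ∙ ι s)) xor alternating n (suc j) x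

    alternating-+ : ∀ n k j x →
      alternating (n + k) j x ≡ alternating n j x xor alternating k (n + j) x
    alternating-+ zero    k j x = ≡.refl
    alternating-+ (suc n) k j x = ≡.trans
      (≡.cong (does (x ≟ ((j · st) ∙ ι s)) xor_)
        (≡.trans (alternating-+ n k (suc j) x)
          (≡.cong (λ i → alternating n (suc j) x xor alternating k i x) (ℕ.+-suc n j))))
      (≡.sym (xor-assoc (does (x ≟ ((j · st) ∙ ι s))) _ _))

    alternating-periodic : ∀ {k} → k · st ≈ ε → ∀ n j x →
      alternating n (k + j) x ≡ alternating n j x
    alternating-periodic p zero    j x = ≡.refl
    alternating-periodic {k} p (suc n) j x = ≡.cong₂ _xor_
      (does-≟-cong refl (∙-congʳ (trans (×-homo-+ st k j) (trans (∙-congʳ p) (identityˡ _)))))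
      (≡.trans (≡.cong (λ i → alternating n i x) (≡.sym (ℕ.+-suc k j)))
        (alternating-periodic {k} p n (suc j) x))

    ·-comm : ∀ j → (j · st) ∙ st ≈ st ∙ (j · st)
    ·-comm j = begin
      (j · st) ∙ st      ≈⟨ ∙-congˡ (×-homo-1 st) ⟨
      (j · st) ∙ (1 · st) ≈⟨ ×-homo-+ st j 1 ⟨
      (j + 1) · st       ≡⟨ ≡.cong (_· st) (ℕ.+-comm j 1) ⟩
      st ∙ (j · st)      ∎

    conj-shift : ∀ j → (ι s ∙ ((ι t ∙ ((j · st) ∙ ι s)) ∙ ι t)) ∙ ι s ≈ (suc (suc j) · st) ∙ ι s
    conj-shift j = begin
      (ι s ∙ ((ι t ∙ ((j · st) ∙ ι s)) ∙ ι t)) ∙ ι s   ≈⟨ shuffle (j · st) ⟩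
      (st ∙ ((j · st) ∙ st)) ∙ ι s                    ≈⟨ ∙-congʳ (∙-congˡ (·-comm j)) ⟩
      (st ∙ (st ∙ (j · st))) ∙ ι s                    ∎
      where
      shuffle : ∀ y → (ι s ∙ ((ι t ∙ (y ∙ ι s)) ∙ ι t)) ∙ ι s ≈ ((ι s ∙ ι t) ∙ (y ∙ (ι s ∙ ι t))) ∙ ι s
      shuffle y = solve monoid

    -- Reading one pair `s`, `t` replaces `x` by t s x s t; carrying the conjugation to the other
    -- side of each test turns (st)ʲ s into (st)ʲ⁺² s.
    alternating-shift : ∀ n j x →
      alternating n j ((ι t ∙ ((ι s ∙ x) ∙ ι s)) ∙ ι t) ≡ alternating n (suc (suc j)) x
    alternating-shift zero    j x = ≡.refl
    alternating-shift (suc n) j x = ≡.cong₂ _xor_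
      (does-⇔ (mk⇔ to from) (_ ≟ _) (_ ≟ _)) (alternating-shift n (suc j) x)
      where
      to : (ι t ∙ ((ι s ∙ x) ∙ ι s)) ∙ ι t ≈ (j · st) ∙ ι s → x ≈ (suc (suc j) · st) ∙ ι s
      to p = trans (conj-transpose s (conj-transpose t p)) (conj-shift j)
      from : x ≈ (suc (suc j) · st) ∙ ι s → (ι t ∙ ((ι s ∙ x) ∙ ι s)) ∙ ι t ≈ (j · st) ∙ ι s
      from p = sym (conj-transpose t (conj-transpose s (trans (conj-shift j) (sym p))))

    parity-power : ∀ k x → parity (power k (s ∷ t ∷ [])) x ≡ alternating (k + k) 0 x
    parity-power zero    x = ≡.refl
    parity-power (suc k) x rewrite ℕ.+-suc k k = ≡.cong₂ _xor_
      (does-≟-cong refl (sym (identityˡ _)))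
      (≡.cong₂ _xor_
        (does-⇔ (mk⇔ (λ p → trans (conj-transpose s p) (∙-congʳ (sym (×-homo-1 st))))
                     (λ p → sym (conj-transpose s (sym (trans p (∙-congʳ (×-homo-1 st)))))))
                (_ ≟ _) (_ ≟ _))
        (≡.trans (parity-power k _) (alternating-shift (k + k) 0 x)))

    ⟦power⟧ : ∀ k → ⟦ power k (s ∷ t ∷ []) ⟧ ≈ k · st
    ⟦power⟧ zero    = refl
    ⟦power⟧ (suc k) = trans (∙-congˡ (∙-congˡ (⟦power⟧ k))) (sym (assoc _ _ _))

    parity-relation : ∀ x → parity (power (m s t) (s ∷ t ∷ [])) x ≡ false
    parity-relation x = ≡.trans (parity-power k x) (≡.trans (alternating-+ k k 0 x)
      (≡.trans (≡.cong (alternating k 0 x xor_) (alternating-periodic {k} st^k≈ε k 0 x))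
        (xor-same (alternating k 0 x))))
      where
      k = m s t
      st^k≈ε : k · st ≈ ε
      st^k≈ε = trans (sym (⟦power⟧ k)) (Equivalence.from (m-order s t k) ∣-refl)

  -- With `presentation`, this makes parity a function of the group element. The congruence case
  -- also uses `presentation`, because the argument passed to the second factor is conjugated by the
  -- value of the first.
  parity-~ : m ⊢ u ~ v → ∀ t → parity u t ≡ parity v t
  parity-~ ~-refl        t = ≡.refl
  parity-~ (~-sym p)     t = ≡.sym (parity-~ p t)
  parity-~ (~-trans p q) t = ≡.trans (parity-~ p t) (parity-~ q t)
  parity-~ (~-cong {u} {u′} {v} {v′} p q) t = begin
    parity (u ++ v) t                                      ≡⟨ parity-++ u v t ⟩
    parity u t xor parity v ((⟦ u ⟧ ⁻¹ ∙ t) ∙ ⟦ u ⟧)       ≡⟨ ≡.cong₂ _xor_ (parity-~ p t) (parity-~ q _) ⟩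
    parity u′ t xor parity v′ ((⟦ u ⟧ ⁻¹ ∙ t) ∙ ⟦ u ⟧)     ≡⟨ ≡.cong (parity u′ t xor_)
      (parity-congʳ v′ (∙-cong (∙-congʳ (⁻¹-cong u≈u′)) u≈u′)) ⟩
    parity u′ t xor parity v′ ((⟦ u′ ⟧ ⁻¹ ∙ t) ∙ ⟦ u′ ⟧)   ≡⟨ parity-++ u′ v′ t ⟨
    parity (u′ ++ v′) t                                    ∎
    where
    open ≡.≡-Reasoning
    u≈u′ : ⟦ u ⟧ ≈ ⟦ u′ ⟧
    u≈u′ = Equivalence.from (presentation u u′) p
  parity-~ (~-rel s t) x = parity-relation s t x

  parity-congˡ : ⟦ u ⟧ ≈ ⟦ v ⟧ → ∀ t → parity u t ≡ parity v t
  parity-congˡ {u} {v} p = parity-~ (Equivalence.to (presentation u v) p)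

  -- An odd count is not zero, so `t` is s₁ ⋯ sᵢ ⋯ s₁ for some i, and multiplying by it cancels the
  -- letter sᵢ. The sublist is recorded so that the new word uses only letters of the old one.
  deletion : ∀ u t → parity u t ≡ true →
    ∃[ u′ ] (⟦ u′ ⟧ ≈ t ∙ ⟦ u ⟧ × length u′ < length u × u′ ⊆ u)
  deletion (s ∷ u) t odd with t ≟ ι s
  ... | yes t≈s = u , sym (trans (∙-congʳ t≈s) (ιι-cancel s _)) , ℕ.≤-refl , s ∷ʳ ⊆-refl
  ... | no  _   with u′ , eq , len , sub ← deletion u _ odd =
    s ∷ u′ , trans (∙-congˡ eq) eq′ , s≤s len , ≡.refl ∷ sub
    where
    open ≈-Reasoning setoid
    eq′ : ι s ∙ (((ι s ∙ t) ∙ ι s) ∙ ⟦ u ⟧) ≈ t ∙ (ι s ∙ ⟦ u ⟧)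
    eq′ = begin
      ι s ∙ (((ι s ∙ t) ∙ ι s) ∙ ⟦ u ⟧)   ≈⟨ solve monoid ⟩
      ι s ∙ (ι s ∙ (t ∙ (ι s ∙ ⟦ u ⟧)))   ≈⟨ ιι-cancel s _ ⟩
      t ∙ (ι s ∙ ⟦ u ⟧)                   ∎

  -- Prefixing the letter `s` counts `ι s` once and fixes it under the conjugation, so the parity at
  -- `ι s` flips.
  parity-ι∙ : ∀ s u v → ⟦ v ⟧ ≈ ι s ∙ ⟦ u ⟧ → not (parity v (ι s)) ≡ parity u (ι s)
  parity-ι∙ s u v v≈su = begin
    not (parity v (ι s))                 ≡⟨ ≡.cong not (parity-congʳ v
      (trans (∙-congʳ (ι-involutive s)) (identityˡ _))) ⟨
    not (parity v ((ι s ∙ ι s) ∙ ι s))   ≡⟨ ≡.cong (_xor parity v ((ι s ∙ ι s) ∙ ι s))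
      (dec-true (ι s ≟ ι s) refl) ⟨
    parity (s ∷ v) (ι s)                 ≡⟨ parity-congˡ {s ∷ v} {u}
      (trans (∙-congˡ v≈su) (ιι-cancel s _)) (ι s) ⟩
    parity u (ι s)                       ∎
    where open ≡.≡-Reasoning

  -- Were the parity even, it would be odd for a reduced word of `ι s ∙ ⟦ u ⟧`, and deletion there
  -- would give too short a word for `⟦ u ⟧`. The weak hypothesis lets `ℓ-descent` exclude equal
  -- lengths.
  descent-odd : ∀ s u → ℓ (ι s ∙ ⟦ u ⟧) ≤ ℓ ⟦ u ⟧ → parity u (ι s) ≡ true
  descent-odd s u ℓsu≤ℓu with parity u (ι s) in eq
  ... | true  = ≡.refl
  ... | false with v , v≈su , lenv ← ℓ-attained (ι s ∙ ⟦ u ⟧)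
              with v′ , v′≈sv , len , _ ← deletion v (ι s)
                     (not-injective (≡.trans (parity-ι∙ s u v v≈su) eq))
    = contradiction ℓsu≤ℓu (ℕ.<⇒≱ (ℕ.≤-<-trans
        (ℓ-minimal ⟦ u ⟧ v′ (trans v′≈sv (trans (∙-congˡ v≈su) (ιι-cancel s _))))
        (≡.subst (length v′ <_) lenv len)))

  -- The exchange condition

  ℓ-descent : ∀ s x → ℓ (ι s ∙ x) ≤ ℓ x → ℓ (ι s ∙ x) < ℓ x
  ℓ-descent s x sx≤x with u , u≈x , len ← ℓ-attained x
    with u′ , u′≈su , len′ , _ ← deletion u (ι s) (descent-odd s u
           (≡.subst₂ _≤_ (ℓ-cong (∙-congˡ (sym u≈x))) (ℓ-cong (sym u≈x)) sx≤x))
    = ℕ.≤-<-trans (ℓ-minimal _ u′ (trans u′≈su (∙-congˡ u≈x))) (≡.subst (length u′ <_) len len′)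

  ℓ-ascent : ∀ s x → ¬ (ℓ (ι s ∙ x) < ℓ x) → ℓ (ι s ∙ x) ≡ suc (ℓ x)
  ℓ-ascent s x sx≮x = ℕ.≤-antisym (ℓ-ι∙ s x)
    (ℕ.≰⇒> λ sx≤x → sx≮x (ℓ-descent s x sx≤x))

  -- By `parity-++` the odd count for a word of `x ∙ y` is odd on exactly one of the two factors,
  -- and a letter is deleted there.
  exchange : ∀ s x y → ℓ (ι s ∙ (x ∙ y)) < ℓ (x ∙ y) →
    ℓ (ι s ∙ x) < ℓ x ⊎ ∃[ y′ ] (ι s ∙ (x ∙ y) ≈ x ∙ y′ × ℓ y′ < ℓ y)
  exchange s x y lt
    with u , u≈x , lenu ← ℓ-attained x | v , v≈y , lenv ← ℓ-attained y
    with uv≈xy ← trans (⟦⟧-++ u v) (∙-cong u≈x v≈y)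
    with parity u (ι s) in eq
       | ≡.trans (≡.sym (parity-++ u v (ι s))) (descent-odd s (u ++ v) (ℕ.<⇒≤
           (≡.subst₂ _<_ (ℓ-cong (∙-congˡ (sym uv≈xy))) (ℓ-cong (sym uv≈xy)) lt)))
  ... | true  | _ with u′ , u′≈su , len , _ ← deletion u (ι s) eq =
    inj₁ (ℕ.≤-<-trans (ℓ-minimal _ u′ (trans u′≈su (∙-congˡ u≈x))) (≡.subst (length u′ <_) lenu len))
  ... | false | odd with v′ , v′≈tv , len , _ ← deletion v _ odd =
    inj₂ (⟦ v′ ⟧ , sy≈ , ℕ.≤-<-trans (ℓ-⟦⟧ v′) (≡.subst (length v′ <_) lenv len))
    where
    open ≈-Reasoning setoid
    sy≈ : ι s ∙ (x ∙ y) ≈ x ∙ ⟦ v′ ⟧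
    sy≈ = begin
      ι s ∙ (x ∙ y)                                        ≈⟨ ∙-congˡ (∙-cong u≈x v≈y) ⟨
      ι s ∙ (⟦ u ⟧ ∙ ⟦ v ⟧)                                ≈⟨ cancelˡ (inverseʳ ⟦ u ⟧) _ ⟨
      ⟦ u ⟧ ∙ (⟦ u ⟧ ⁻¹ ∙ (ι s ∙ (⟦ u ⟧ ∙ ⟦ v ⟧)))         ≈⟨ solve monoid ⟩
      ⟦ u ⟧ ∙ (((⟦ u ⟧ ⁻¹ ∙ ι s) ∙ ⟦ u ⟧) ∙ ⟦ v ⟧)         ≈⟨ ∙-cong u≈x (sym v′≈tv) ⟩
      x ∙ ⟦ v′ ⟧                                           ∎

  -- Letters are added from the right end, and one is deleted whenever the length drops.
  -- Consequently an element of `Parabolic M` has a reduced word in `M`.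
  reduce : ∀ u → ∃[ u′ ] (⟦ u′ ⟧ ≈ ⟦ u ⟧ × length u′ ≡ ℓ ⟦ u ⟧ × u′ ⊆ u)
  reduce [] = [] , refl , ≡.sym ℓ-ε , []
  reduce (s ∷ u) with u′ , u′≈u , len , sub ← reduce u | ℓ (ι s ∙ ⟦ u ⟧) <? ℓ ⟦ u ⟧
  ... | no  ascent = s ∷ u′ , ∙-congˡ u′≈u , ≡.trans (≡.cong suc len) (≡.sym (ℓ-ascent s _ ascent)) ,
                     ≡.refl ∷ sub
  ... | yes descent with u″ , u″≈su′ , len″ , sub″ ← deletion u′ (ι s) (descent-odd s u′ (ℕ.<⇒≤
          (≡.subst₂ _<_ (ℓ-cong (∙-congˡ (sym u′≈u))) (ℓ-cong (sym u′≈u)) descent)))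
    with u″≈su ← trans u″≈su′ (∙-congˡ u′≈u)
    -- The new word is shorter than ℓ(u), and ℓ(u) ≤ ℓ(su) + 1, so it is reduced.
    = u″ , u″≈su , ℕ.≤-antisym
        (s≤s⁻¹ (ℕ.≤-trans len″ (ℕ.≤-trans (ℕ.≤-reflexive len) (ℓ-ι∙′ s _))))
        (ℓ-minimal _ u″ u″≈su) , s ∷ʳ ⊆-trans sub″ sub

  reduced-tail : ∀ s u → length (s ∷ u) ≡ ℓ ⟦ s ∷ u ⟧ → length u ≡ ℓ ⟦ u ⟧
  reduced-tail s u len =
    ℕ.≤-antisym (s≤s⁻¹ (≡.subst (_≤ suc (ℓ ⟦ u ⟧)) (≡.sym len) (ℓ-ι∙ s _))) (ℓ-⟦⟧ u)

  length-one : ℓ x ≤ 1 → ¬ (x ≈ ε) → ∃[ s ] ι s ≈ x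
  length-one {x} ℓx≤1 x≉ε with ℓ-attained x
  ... | []        , ε≈x , _   = contradiction (sym ε≈x) x≉ε
  ... | s ∷ []    , s≈x , _   = s , trans (sym (identityʳ _)) s≈x
  ... | _ ∷ _ ∷ _ , _   , len = contradiction (≡.subst (_≤ 1) (≡.sym len) ℓx≤1) λ { (s≤s ()) }

  -- Parabolic subgroups

  private variable
    M : Pred S a

  parabolic-resp : x ≈ y → x ∈ Parabolic M → y ∈ Parabolic M
  parabolic-resp x≈y (u , all , u≈x) = u , all , trans u≈x x≈y

  parabolic-ε : ε ∈ Parabolic M
  parabolic-ε = [] , [] , refl

  parabolic-∙ : x ∈ Parabolic M → y ∈ Parabolic M → x ∙ y ∈ Parabolic M
  parabolic-∙ (u , allu , u≈x) (v , allv , v≈y) =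
    u ++ v , All.++⁺ allu allv , trans (⟦⟧-++ u v) (∙-cong u≈x v≈y)

  parabolic-ι : ∀ {s} → s ∈ M → ι s ∈ Parabolic M
  parabolic-ι s∈M = _ ∷ [] , s∈M ∷ [] , identityʳ _

  parabolic-⁻¹ : x ∈ Parabolic M → x ⁻¹ ∈ Parabolic M
  parabolic-⁻¹ (u , all , u≈x) = parabolic-resp (⁻¹-cong u≈x) (go u all)
    where
    go : ∀ u → All M u → ⟦ u ⟧ ⁻¹ ∈ Parabolic M
    go []      []          = parabolic-resp (sym ε⁻¹≈ε) parabolic-ε
    go (s ∷ u) (s∈M ∷ all) = parabolic-resp
      (trans (∙-congˡ (sym (ι⁻¹ s))) (sym (⁻¹-anti-homo-∙ _ _)))
      (parabolic-∙ (go u all) (parabolic-ι s∈M))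

  parabolic-mono : {M N : Pred S a} → M ⊆ᵖ N →
    x ∈ Parabolic M → x ∈ Parabolic N
  parabolic-mono M⊆N (u , all , u≈x) = u , All.map M⊆N all , u≈x

  -- The induction runs along a reduced word in `M`, whose tails are again reduced; hence every
  -- extension may assume that the length rises.
  parabolic-induction : ∀ {p} (P : Pred Carrier p) → (∀ {x y} → x ≈ y → P x → P y) → P ε →
    (∀ s w → s ∈ M → w ∈ Parabolic M → ℓ (ι s ∙ w) ≡ suc (ℓ w) → P w → P (ι s ∙ w)) →
    w ∈ Parabolic M → P w
  parabolic-induction P resp Pε extend (u , all , u≈w) with u′ , u′≈u , len , sub ← reduce u =
    resp (trans u′≈u u≈w) (go u′ (≡.trans len (ℓ-cong (sym u′≈u))) (All-resp-⊆ sub all))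
    where
    go : ∀ u → length u ≡ ℓ ⟦ u ⟧ → All _ u → P ⟦ u ⟧
    go []      _   []          = Pε
    go (s ∷ u) len (s∈M ∷ all) = extend s ⟦ u ⟧ s∈M (u , all , refl)
      (≡.trans (≡.sym len) (≡.cong suc lenu)) (go u lenu all)
      where
      lenu : length u ≡ ℓ ⟦ u ⟧
      lenu = reduced-tail s u len

  ι∈parabolic : ∀ s → ι s ∈ Parabolic M → s ∈ M
  ι∈parabolic {M} s (u , all , u≈s) with u′ , u′≈u , len , sub ← reduce u
    with u′ | All-resp-⊆ sub all | u′≈u
       | ≡.subst (_≤ 1) (≡.sym (≡.trans len (ℓ-cong u≈s))) (ℓ-ι s)
  ... | []        | []      | ε≈u | _ = contradiction (sym (trans ε≈u u≈s)) (ι-nontrivial s)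
  ... | i ∷ []    | i∈M ∷ _ | i≈u | _ =
    ≡.subst (_∈ M) (ι-injective (trans (sym (identityʳ _)) (trans i≈u u≈s))) i∈M
  ... | _ ∷ _ ∷ _ | _       | _   | s≤s ()

  -- Deletion in a word for `w` with letters in `M` puts `ι s ∙ w`, and hence `ι s`, into W_M.
  parabolic-descent : ∀ s → w ∈ Parabolic M → ℓ (ι s ∙ w) ≤ ℓ w → s ∈ M
  parabolic-descent s (v , all , v≈w) sw≤w
    with v′ , v′≈sv , _ , sub ← deletion v (ι s) (descent-odd s v
           (≡.subst₂ _≤_ (ℓ-cong (∙-congˡ (sym v≈w))) (ℓ-cong (sym v≈w)) sw≤w))
    = ι∈parabolic s (parabolic-resp (trans (∙-congʳ v′≈sv) (cancelʳ (inverseʳ _) _))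
        (parabolic-∙ (v′ , All-resp-⊆ sub all , refl) (parabolic-⁻¹ (v , all , refl))))

  -- The first letter of a reduced word is a left descent, so `parabolic-descent` applies letter by
  -- letter. One reduced word thus settles membership in W_M.
  parabolic-support : ∀ u → length u ≡ ℓ ⟦ u ⟧ → ⟦ u ⟧ ∈ Parabolic M → All M u
  parabolic-support [] _ _ = []
  parabolic-support {M} (s ∷ u) len su∈ =
    s∈M ∷ parabolic-support u (reduced-tail s u len)
      (parabolic-resp (ιι-cancel s _) (parabolic-∙ (parabolic-ι s∈M) su∈))
    where
    open ℕ.≤-Reasoning
    s∈M : s ∈ M
    s∈M = parabolic-descent s su∈ (begin
      ℓ (ι s ∙ (ι s ∙ ⟦ u ⟧))   ≡⟨ ℓ-cong (ιι-cancel s _) ⟩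
      ℓ ⟦ u ⟧                   ≤⟨ ℓ-⟦⟧ u ⟩
      length u                  ≤⟨ ℕ.n≤1+n _ ⟩
      length (s ∷ u)            ≡⟨ len ⟩
      ℓ (ι s ∙ ⟦ u ⟧)           ∎)

  ∈parabolic? : Decidable M → Decidable (Parabolic M)
  ∈parabolic? M? w with u , u≈w , len ← ℓ-attained w = map′
    (λ all → u , all , u≈w)
    (λ w∈ → parabolic-support u (≡.trans len (ℓ-cong (sym u≈w))) (parabolic-resp (sym u≈w) w∈))
    (All.all? M? u)

  -- If `s` were a descent of `w ∙ x` but not of `w`, exchange would make w⁻¹ s w x shorter than
  -- `x`, against minimality.
  minimal⇒additive : (∀ {w} → w ∈ Parabolic M → ℓ x ≤ ℓ (w ∙ x)) →
    w ∈ Parabolic M → ℓ (w ∙ x) ≡ ℓ w + ℓ x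
  minimal⇒additive {M} {x} min = parabolic-induction (λ w → ℓ (w ∙ x) ≡ ℓ w + ℓ x)
    (λ p e → ≡.subst₂ (λ i j → i ≡ j + ℓ x) (ℓ-cong (∙-congʳ p)) (ℓ-cong p) e)
    (≡.trans (ℓ-cong (identityˡ x)) (≡.cong (_+ ℓ x) (≡.sym ℓ-ε)))
    λ s w s∈M w∈ sw≡ ih → begin
      ℓ ((ι s ∙ w) ∙ x)     ≡⟨ ℓ-cong (assoc _ _ _) ⟩
      ℓ (ι s ∙ (w ∙ x))     ≡⟨ ℓ-ascent s _ (no-descent s w s∈M w∈ sw≡) ⟩
      suc (ℓ (w ∙ x))       ≡⟨ ≡.cong suc ih ⟩
      suc (ℓ w) + ℓ x       ≡⟨ ≡.cong (_+ ℓ x) sw≡ ⟨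
      ℓ (ι s ∙ w) + ℓ x     ∎
    where
    open ≡.≡-Reasoning
    no-descent : ∀ s w → s ∈ M → w ∈ Parabolic M → ℓ (ι s ∙ w) ≡ suc (ℓ w) →
      ¬ (ℓ (ι s ∙ (w ∙ x)) < ℓ (w ∙ x))
    no-descent s w s∈M w∈ sw≡ lt with exchange s w x lt
    ... | inj₁ sw<w = ℕ.<-asym sw<w (ℕ.≤-reflexive (≡.sym sw≡))
    ... | inj₂ (x′ , swx≈wx′ , x′<x) = ℕ.<⇒≱ x′<x
      (≡.subst (ℓ x ≤_) (ℓ-cong eq) (min (parabolic-∙ (parabolic-∙ (parabolic-⁻¹ w∈) (parabolic-ι s∈M)) w∈)))
      where
      eq : ((w ⁻¹ ∙ ι s) ∙ w) ∙ x ≈ x′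
      eq = trans (assoc _ _ _) (trans (assoc _ _ _) (trans (∙-congˡ swx≈wx′) (cancelˡ (inverseˡ w) x′)))

  -- Elements whose left descents include a given set.

  module _ {M : Pred S a} {g : Carrier} (descents : ∀ {s} → s ∈ M → ℓ (ι s ∙ g) < ℓ g) where

    -- Write g = w h. In the inductive step `s` is a descent of `g` but not of `w`, so exchange
    -- makes the new remainder w⁻¹ s g shorter than h. Subadditivity of `ℓ` gives the other
    -- inequality.
    parabolic-prefix : w ∈ Parabolic M → ℓ w + ℓ (w ⁻¹ ∙ g) ≡ ℓ g
    parabolic-prefix = parabolic-induction (λ w → ℓ w + ℓ (w ⁻¹ ∙ g) ≡ ℓ g)
      (λ p e → ≡.subst₂ (λ i j → i + j ≡ ℓ g) (ℓ-cong p) (ℓ-cong (∙-congʳ (⁻¹-cong p))) e)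
      (≡.cong₂ _+_ ℓ-ε (ℓ-cong (trans (∙-congʳ ε⁻¹≈ε) (identityˡ g))))
      extend
      where
      extend : ∀ s w → s ∈ M → w ∈ Parabolic M → ℓ (ι s ∙ w) ≡ suc (ℓ w) →
        ℓ w + ℓ (w ⁻¹ ∙ g) ≡ ℓ g → ℓ (ι s ∙ w) + ℓ ((ι s ∙ w) ⁻¹ ∙ g) ≡ ℓ g
      extend s w s∈M w∈ sw≡ ih with w∙h≈g ← cancelˡ (inverseʳ w) g
        with exchange s w (w ⁻¹ ∙ g)
               (≡.subst₂ _<_ (ℓ-cong (∙-congˡ (sym w∙h≈g))) (ℓ-cong (sym w∙h≈g)) (descents s∈M))
      ... | inj₁ sw<w = contradiction (ℕ.≤-reflexive (≡.sym sw≡)) (ℕ.<-asym sw<w)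
      ... | inj₂ (h′ , sg≈wh′ , h′<h) = ℕ.≤-antisym
        (begin
          ℓ (ι s ∙ w) + ℓ ((ι s ∙ w) ⁻¹ ∙ g)    ≡⟨ ≡.cong₂ _+_ sw≡ (ℓ-cong eq) ⟩
          suc (ℓ w) + ℓ h′                      ≡⟨ ℕ.+-suc (ℓ w) (ℓ h′) ⟨
          ℓ w + suc (ℓ h′)                      ≤⟨ ℕ.+-monoʳ-≤ (ℓ w) h′<h ⟩
          ℓ w + ℓ (w ⁻¹ ∙ g)                    ≡⟨ ih ⟩
          ℓ g                                   ∎)
        (begin
          ℓ g                                   ≡⟨ ℓ-cong (cancelˡ (inverseʳ (ι s ∙ w)) g) ⟨
          ℓ ((ι s ∙ w) ∙ ((ι s ∙ w) ⁻¹ ∙ g))    ≤⟨ ℓ-∙ _ _ ⟩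
          ℓ (ι s ∙ w) + ℓ ((ι s ∙ w) ⁻¹ ∙ g)    ∎)
        where
        open ℕ.≤-Reasoning
        eq : (ι s ∙ w) ⁻¹ ∙ g ≈ h′
        eq = begin≈
          (ι s ∙ w) ⁻¹ ∙ g                ≈⟨ ∙-congʳ (⁻¹-anti-homo-∙ _ _) ⟩
          (w ⁻¹ ∙ ι s ⁻¹) ∙ g             ≈⟨ ∙-congʳ (∙-congˡ (ι⁻¹ s)) ⟩
          (w ⁻¹ ∙ ι s) ∙ g                ≈⟨ assoc _ _ _ ⟩
          w ⁻¹ ∙ (ι s ∙ g)                ≈⟨ ∙-congˡ (∙-congˡ w∙h≈g) ⟨
          w ⁻¹ ∙ (ι s ∙ (w ∙ (w ⁻¹ ∙ g))) ≈⟨ ∙-congˡ sg≈wh′ ⟩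
          w ⁻¹ ∙ (w ∙ h′)                 ≈⟨ cancelˡ (inverseˡ w) h′ ⟩
          h′                              ∎≈
          where open ≈-Reasoning setoid using (step-≈-⟩; step-≈-⟨) renaming (begin_ to begin≈_; _∎ to _∎≈)

    ℓ-parabolic∙ : w ∈ Parabolic M → ℓ w + ℓ (w ∙ g) ≡ ℓ g
    ℓ-parabolic∙ {w} w∈ = ≡.trans
      (≡.cong₂ _+_ (≡.sym (ℓ-⁻¹ w)) (ℓ-cong (∙-congʳ (sym (⁻¹-involutive w)))))
      (parabolic-prefix (parabolic-⁻¹ w∈))

    -- By `ℓ-parabolic∙` the length of `w ∙ g` falls by one whenever that of `w` rises, so each step
    -- deletes a letter. A word has finitely many sublists, which bounds W_M.
    parabolic∙-sublist : ∀ u → ⟦ u ⟧ ≈ g → w ∈ Parabolic M → ∃[ v ] (v ⊆ u × ⟦ v ⟧ ≈ w ∙ g)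
    parabolic∙-sublist u u≈g = parabolic-induction (λ w → ∃[ v ] (v ⊆ u × ⟦ v ⟧ ≈ w ∙ g))
      (λ { p (v , sub , eq) → v , sub , trans eq (∙-congʳ p) })
      (u , ⊆-refl , trans u≈g (sym (identityˡ g)))
      extend
      where
      extend : ∀ s w → s ∈ M → w ∈ Parabolic M → ℓ (ι s ∙ w) ≡ suc (ℓ w) →
        ∃[ v ] (v ⊆ u × ⟦ v ⟧ ≈ w ∙ g) → ∃[ v ] (v ⊆ u × ⟦ v ⟧ ≈ (ι s ∙ w) ∙ g)
      extend s w s∈M w∈ sw≡ (v , sub , v≈wg) =
        let v′ , v′≈sv , _ , sub′ = deletion v (ι s) (descent-odd s v (ℕ.<⇒≤ descent))
        in v′ , ⊆-trans sub′ sub , trans v′≈sv (trans (∙-congˡ v≈wg) (sym (assoc _ _ _)))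
        where
        open ≡.≡-Reasoning
        descent : ℓ (ι s ∙ ⟦ v ⟧) < ℓ ⟦ v ⟧
        descent = ℕ.≤-reflexive (ℕ.+-cancelˡ-≡ (ℓ w) _ _ (begin
          ℓ w + suc (ℓ (ι s ∙ ⟦ v ⟧))           ≡⟨ ℕ.+-suc (ℓ w) _ ⟩
          suc (ℓ w) + ℓ (ι s ∙ ⟦ v ⟧)           ≡⟨ ≡.cong₂ _+_ (≡.sym sw≡) (ℓ-cong (trans (∙-congˡ v≈wg) (sym (assoc _ _ _)))) ⟩
          ℓ (ι s ∙ w) + ℓ ((ι s ∙ w) ∙ g)       ≡⟨ ℓ-parabolic∙ (parabolic-∙ (parabolic-ι s∈M) w∈) ⟩
          ℓ g                                   ≡⟨ ℓ-parabolic∙ w∈ ⟨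
          ℓ w + ℓ (w ∙ g)                       ≡⟨ ≡.cong (ℓ w +_) (ℓ-cong v≈wg) ⟨
          ℓ w + ℓ ⟦ v ⟧                         ∎))

    abstract
      parabolic-finite : Decidable M →
        ∃[ ws ] (∀ w → w ∈ Parabolic M ⇔ Any (w ≈_) ws)
      parabolic-finite M? with u , u≈g , _ ← ℓ-attained g =
        -- Each sublist `v` proposes `⟦ v ⟧ ∙ g ⁻¹`; proposals outside W_M are filtered out.
        filter (∈parabolic? M?) (map (λ v → ⟦ v ⟧ ∙ g ⁻¹) (sublists u)) , λ w → mk⇔
          (λ w∈ → let v , sub , v≈wg = parabolic∙-sublist u u≈g w∈ in
            ∈-filter⁺ setoid (∈parabolic? M?) parabolic-resp
              (Any.map⁺ (Any.map
                (λ { ≡.refl → sym (trans (∙-congʳ v≈wg) (cancelʳ (inverseʳ g) w)) })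
                (∈-sublists sub)))
              w∈)
          (λ w∈ → proj₂ (∈-filter⁻ setoid (∈parabolic? M?) parabolic-resp
            {xs = map (λ v → ⟦ v ⟧ ∙ g ⁻¹) (sublists u)} w∈))

    descents⇒finitary : Decidable M → Finitary
    descents⇒finitary M? = record
      { subset      = M
      ; elements    = proj₁ (parabolic-finite M?)
      ; enumeration = proj₂ (parabolic-finite M?)
      }

  -- Longest elements of finite parabolic subgroups.

  module _ (K : Finitary) where
    open Finitary K using (elements; enumeration)

    longest∈ : w[ K ] ∈ Parabolic (subset K)
    longest∈ with argmax-sel ℓ ε elements
    -- The default value `ε` of `argmax` lies in W_K as well.
    ... | inj₁ ≡ε = parabolic-resp (reflexive (≡.sym ≡ε)) parabolic-ε
    ... | inj₂ ∈elements = Equivalence.from (enumeration _) (Any.map reflexive ∈elements)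

    longest-maximal : w ∈ Parabolic (subset K) → ℓ w ≤ ℓ w[ K ]
    longest-maximal {w} w∈ = v≤f[argmax]⁺ ε elements
      (inj₂ (Any.map ℓ-resp-≤ (Equivalence.to (enumeration w) w∈)))

    longest-descent : ∀ {s} → s ∈ subset K → ℓ (ι s ∙ w[ K ]) < ℓ w[ K ]
    longest-descent s∈K = ℓ-descent _ _ (longest-maximal (parabolic-∙ (parabolic-ι s∈K) longest∈))

    -- Since W_K meets `S` exactly in `K`, the enumeration of W_K decides membership in `K`.
    ∈-finitary? : Decidable (subset K)
    ∈-finitary? s = map′
      (λ p → ι∈parabolic s (Equivalence.from (enumeration _) p))
      (λ s∈K → Equivalence.to (enumeration _) (parabolic-ι s∈K))
      (any? (ι s ≟_) elements)

    longest-involutive : w[ K ] ∙ w[ K ] ≈ ε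
    longest-involutive = ℓ≡0⇒≈ε (ℕ.+-cancelˡ-≡ (ℓ w[ K ]) _ _
      (≡.trans (ℓ-parabolic∙ longest-descent longest∈) (≡.sym (ℕ.+-identityʳ _))))

    longest-cancel : ∀ x → w[ K ] ∙ (w[ K ] ∙ x) ≈ x
    longest-cancel = cancelˡ longest-involutive

    -- For s ∈ K, σ = w_K s w_K lies in W_K and σ w_K = w_K s has length ≥ ℓ(w_K) - 1,
    -- whereas it has length ℓ(w_K) - ℓ(σ).
    longest-conjugate : ∀ {s} → s ∈ subset K → ∃[ t ] (t ∈ subset K × ι t ≈ (w[ K ] ∙ ι s) ∙ w[ K ])
    longest-conjugate {s} s∈K = let t , t≈σ = length-one ℓσ≤1 σ≉ε in
      t , ι∈parabolic t (parabolic-resp (sym t≈σ) σ∈) , t≈σ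
      where
      wK σ : Carrier
      wK = w[ K ]
      σ = (wK ∙ ι s) ∙ wK
      σ∈ : σ ∈ Parabolic (subset K)
      σ∈ = parabolic-∙ (parabolic-∙ longest∈ (parabolic-ι s∈K)) longest∈
      σ∙wK : σ ∙ wK ≈ wK ∙ ι s
      σ∙wK = cancelʳ longest-involutive _
      ℓσ≤1 : ℓ σ ≤ 1
      ℓσ≤1 = ℕ.+-cancelʳ-≤ (ℓ (wK ∙ ι s)) _ _ (begin
        ℓ σ + ℓ (wK ∙ ι s)        ≡⟨ ≡.cong (ℓ σ +_) (ℓ-cong (sym σ∙wK)) ⟩
        ℓ σ + ℓ (σ ∙ wK)          ≡⟨ ℓ-parabolic∙ longest-descent σ∈ ⟩
        ℓ wK                      ≡⟨ ℓ-cong (cancelʳ (ι-involutive s) wK) ⟨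
        ℓ ((wK ∙ ι s) ∙ ι s)      ≤⟨ ℓ-∙ _ _ ⟩
        ℓ (wK ∙ ι s) + ℓ (ι s)    ≤⟨ ℕ.+-monoʳ-≤ _ (ℓ-ι s) ⟩
        ℓ (wK ∙ ι s) + 1          ≡⟨ ℕ.+-comm _ 1 ⟩
        1 + ℓ (wK ∙ ι s)          ∎)
        where open ℕ.≤-Reasoning
      σ≉ε : ¬ (σ ≈ ε)
      σ≉ε σ≈ε = ι-nontrivial s (begin
        ι s                       ≈⟨ longest-cancel (ι s) ⟨
        wK ∙ (wK ∙ ι s)           ≈⟨ ∙-congˡ (cancelʳ longest-involutive _) ⟨
        wK ∙ (σ ∙ wK)             ≈⟨ ∙-congˡ (∙-congʳ σ≈ε) ⟩
        wK ∙ (ε ∙ wK)             ≈⟨ ∙-congˡ (identityˡ wK) ⟩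
        wK ∙ wK                   ≈⟨ longest-involutive ⟩
        ε                         ∎)
        where open ≈-Reasoning setoid

  -- Intertwining elements

  -- That is, x⁻¹ A x ⊂ B, written without inverses so that instances chain along a product through
  -- `intertwine-∙`.
  Intertwines : Carrier → Pred S a → Pred S a → Set _
  Intertwines x A B = ∀ {i} → i ∈ A → ∃[ j ] (j ∈ B × ι i ∙ x ≈ x ∙ ι j)

  intertwine-∙ : x ∙ z ≈ z ∙ w → w ∙ y ≈ y ∙ w′ → x ∙ (z ∙ y) ≈ (z ∙ y) ∙ w′
  intertwine-∙ {x} {z} {w} {y} {w′} p q = begin
    x ∙ (z ∙ y)    ≈⟨ assoc _ _ _ ⟨
    (x ∙ z) ∙ y    ≈⟨ ∙-congʳ p ⟩
    (z ∙ w) ∙ y    ≈⟨ assoc _ _ _ ⟩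
    z ∙ (w ∙ y)    ≈⟨ ∙-congˡ q ⟩
    z ∙ (y ∙ w′)   ≈⟨ assoc _ _ _ ⟨
    (z ∙ y) ∙ w′   ∎
    where open ≈-Reasoning setoid

  swap-inverse : x ∙ y ≈ y ∙ z → z ∙ y ⁻¹ ≈ y ⁻¹ ∙ x
  swap-inverse {x} {y} {z} p = begin
    z ∙ y ⁻¹                    ≈⟨ cancelˡ (inverseˡ y) _ ⟨
    y ⁻¹ ∙ (y ∙ (z ∙ y ⁻¹))     ≈⟨ ∙-congˡ (trans (sym (assoc _ _ _)) (∙-congʳ (sym p))) ⟩
    y ⁻¹ ∙ ((x ∙ y) ∙ y ⁻¹)     ≈⟨ ∙-congˡ (cancelʳ (inverseʳ y) x) ⟩
    y ⁻¹ ∙ x                    ∎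
    where open ≈-Reasoning setoid

  intertwine-word : ∀ {A B} → Intertwines x A B → All A u →
    ∃[ v ] (All B v × length v ≡ length u × ⟦ u ⟧ ∙ x ≈ x ∙ ⟦ v ⟧)
  intertwine-word f [] = [] , [] , ≡.refl , trans (identityˡ _) (sym (identityʳ _))
  intertwine-word {x} {i ∷ u} f (i∈A ∷ all) with j , j∈B , ix≈xj ← f i∈A
                                      | v , allv , len , ux≈xv ← intertwine-word f all =
    j ∷ v , j∈B ∷ allv , ≡.cong suc len , (begin
      (ι i ∙ ⟦ u ⟧) ∙ x    ≈⟨ assoc _ _ _ ⟩
      ι i ∙ (⟦ u ⟧ ∙ x)    ≈⟨ ∙-congˡ ux≈xv ⟩
      ι i ∙ (x ∙ ⟦ v ⟧)    ≈⟨ assoc _ _ _ ⟨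
      (ι i ∙ x) ∙ ⟦ v ⟧    ≈⟨ ∙-congʳ ix≈xj ⟩
      (x ∙ ι j) ∙ ⟦ v ⟧    ≈⟨ assoc _ _ _ ⟩
      x ∙ (ι j ∙ ⟦ v ⟧)    ∎)
    where open ≈-Reasoning setoid

  -- A reduced word in `A` passes through `x` letter by letter, so the number of letters is kept and
  -- bounds the new length.
  intertwine-parabolic : ∀ {A B} → Intertwines x A B → w ∈ Parabolic A →
    ∃[ w′ ] (w′ ∈ Parabolic B × ℓ w′ ≤ ℓ w × w ∙ x ≈ x ∙ w′)
  intertwine-parabolic f (u , all , u≈w)
    with u′ , u′≈u , len′ , sub ← reduce u
    with v , allv , len , eq ← intertwine-word f (All-resp-⊆ sub all)
    = ⟦ v ⟧ , (v , allv , refl) ,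
      ℕ.≤-trans (ℓ-⟦⟧ v) (ℕ.≤-reflexive (≡.trans len (≡.trans len′ (ℓ-cong u≈w)))) ,
      trans (∙-congʳ (sym (trans u′≈u u≈w))) eq

  -- The Bruhat order

  ≤ᴮ-respˡ : x ≈ y → x ≤ᴮ z → y ≤ᴮ z
  ≤ᴮ-respˡ x≈y (≤ᴮ-refl x≈z)            = ≤ᴮ-refl (trans (sym x≈y) x≈z)
  ≤ᴮ-respˡ x≈y (≤ᴮ-step t t∈ eq lt x≤z) =
    ≤ᴮ-step t t∈ (trans eq (∙-congʳ x≈y)) (ℕ.≤-<-trans (ℓ-resp-≤ (sym x≈y)) lt) x≤z

  ≤ᴮ-trans : x ≤ᴮ y → y ≤ᴮ z → x ≤ᴮ z
  ≤ᴮ-trans (≤ᴮ-refl x≈y)            q = ≤ᴮ-respˡ (sym x≈y) q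
  ≤ᴮ-trans (≤ᴮ-step t t∈ eq lt x≤y) q = ≤ᴮ-step t t∈ eq lt (≤ᴮ-trans x≤y q)

  ≤ᴮ-respʳ : y ≈ z → x ≤ᴮ y → x ≤ᴮ z
  ≤ᴮ-respʳ y≈z x≤y = ≤ᴮ-trans x≤y (≤ᴮ-refl y≈z)

  ≤ᴮ⇒ℓ≤ : x ≤ᴮ y → ℓ x ≤ ℓ y
  ≤ᴮ⇒ℓ≤ (≤ᴮ-refl x≈y)           = ℓ-resp-≤ x≈y
  ≤ᴮ⇒ℓ≤ (≤ᴮ-step t _ _ lt x≤y) = ℕ.<⇒≤ (ℕ.<-≤-trans lt (≤ᴮ⇒ℓ≤ x≤y))

  ≤ᴮ-ι∙ : ∀ s x → ℓ x < ℓ (ι s ∙ x) → x ≤ᴮ (ι s ∙ x)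
  -- Bruhat steps multiply on the right: s x = x (x⁻¹ s x). The double inverse matches the shape
  -- required by `Reflection`.
  ≤ᴮ-ι∙ s x lt = ≤ᴮ-step ((x ⁻¹ ∙ ι s) ∙ (x ⁻¹) ⁻¹) (x ⁻¹ , s , refl)
    (sym (trans (∙-congˡ (trans (∙-congˡ (⁻¹-involutive x)) (assoc _ _ _))) (cancelˡ (inverseʳ x) _)))
    lt (≤ᴮ-refl refl)

  -- Each letter adds at most one, so a total gain of `length u` forces every partial product to
  -- rise.
  ≤ᴮ-word∙ : ∀ u x → ℓ (⟦ u ⟧ ∙ x) ≡ length u + ℓ x → x ≤ᴮ (⟦ u ⟧ ∙ x)
  ≤ᴮ-word∙ []      x _  = ≤ᴮ-refl (sym (identityˡ x))
  ≤ᴮ-word∙ (s ∷ u) x eq = ≤ᴮ-respʳ (sym (assoc _ _ _))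
    (≤ᴮ-trans (≤ᴮ-word∙ u x ux≡) (≤ᴮ-ι∙ s (⟦ u ⟧ ∙ x) (ℕ.≤-reflexive (≡.sym (begin
      ℓ (ι s ∙ (⟦ u ⟧ ∙ x))    ≡⟨ sux≡ ⟩
      suc (length u + ℓ x)     ≡⟨ ≡.cong suc ux≡ ⟨
      suc (ℓ (⟦ u ⟧ ∙ x))      ∎)))))
    where
    open ≡.≡-Reasoning
    sux≡ : ℓ (ι s ∙ (⟦ u ⟧ ∙ x)) ≡ suc (length u + ℓ x)
    sux≡ = ≡.trans (ℓ-cong (sym (assoc _ _ _))) eq
    ux≡ : ℓ (⟦ u ⟧ ∙ x) ≡ length u + ℓ x
    ux≡ = ℕ.≤-antisym
      (ℕ.≤-trans (ℓ-∙ _ _) (ℕ.+-monoˡ-≤ _ (ℓ-⟦⟧ u)))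
      (s≤s⁻¹ (≡.subst (_≤ suc (ℓ (⟦ u ⟧ ∙ x))) sux≡ (ℓ-ι∙ s _)))

  ≤ᴮ-additive : ℓ (y ∙ x) ≡ ℓ y + ℓ x → x ≤ᴮ (y ∙ x)
  ≤ᴮ-additive {y} {x} eq with u , u≈y , len ← ℓ-attained y =
    ≤ᴮ-respʳ (∙-congʳ u≈y) (≤ᴮ-word∙ u x
      (≡.trans (ℓ-cong (∙-congʳ u≈y)) (≡.trans eq (≡.cong (_+ ℓ x) (≡.sym len)))))

  Minimal : Finitary → Pred Carrier _
  Minimal K x = ∀ {w} → w ∈ Parabolic (subset K) → ℓ x ≤ ℓ (w ∙ x)

  -- With δ = w_K w⁻¹, the product w_K x = δ (w x) is length additive, because ℓ(w_K) = ℓ(δ) + ℓ(w)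
  -- and `minimal⇒additive` applies to both w_K and `w`.
  minimal⇒≤ᴮ : ∀ K → Minimal K x → w ∈ Parabolic (subset K) → (w ∙ x) ≤ᴮ (w[ K ] ∙ x)
  minimal⇒≤ᴮ {x} {w} K min w∈ = ≤ᴮ-respʳ δ∙wx≈ (≤ᴮ-additive (begin
    ℓ (δ ∙ (w ∙ x))           ≡⟨ ℓ-cong δ∙wx≈ ⟩
    ℓ (w[ K ] ∙ x)            ≡⟨ minimal⇒additive min (longest∈ K) ⟩
    ℓ w[ K ] + ℓ x            ≡⟨ ≡.cong (_+ ℓ x) (parabolic-prefix (longest-descent K) δ∈) ⟨
    ℓ δ + ℓ (δ ⁻¹ ∙ w[ K ]) + ℓ x ≡⟨ ≡.cong (λ i → ℓ δ + i + ℓ x) (ℓ-cong δ⁻¹wK≈w) ⟩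
    ℓ δ + ℓ w + ℓ x           ≡⟨ ℕ.+-assoc (ℓ δ) _ _ ⟩
    ℓ δ + (ℓ w + ℓ x)         ≡⟨ ≡.cong (ℓ δ +_) (minimal⇒additive min w∈) ⟨
    ℓ δ + ℓ (w ∙ x)           ∎))
    where
    open ≡.≡-Reasoning
    δ : Carrier
    δ = w[ K ] ∙ w ⁻¹
    δ∈ : δ ∈ Parabolic (subset K)
    δ∈ = parabolic-∙ (longest∈ K) (parabolic-⁻¹ w∈)
    δ∙wx≈ : δ ∙ (w ∙ x) ≈ w[ K ] ∙ x
    δ∙wx≈ = cancelᶜ (inverseˡ w) _ _
    δ⁻¹wK≈w : δ ⁻¹ ∙ w[ K ] ≈ w
    δ⁻¹wK≈w = trans (∙-congʳ (trans (⁻¹-anti-homo-∙ _ _) (∙-congʳ (⁻¹-involutive w))))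
      (cancelʳ (inverseˡ w[ K ]) w)

  -- Elements of W_J move through `x` into W_I, so the double coset is W_I x and `minimal⇒≤ᴮ`
  -- applies.
  minimal⇒maximum : ∀ {I J} (p : DoubleCoset I J) → Minimal I x → Intertwines (x ⁻¹) (subset J) (subset I) →
    x ∈ ⟨ p ⟩ → IsMaximum p (w[ I ] ∙ x)
  minimal⇒maximum {x} {I} {J} p min J→I (b , d , b∈ , d∈ , x≈bpd) = wx∈p , maximal
    where
    open ≈-Reasoning setoid
    q : Carrier
    q = DoubleCoset.representative p
    wx∈p : (w[ I ] ∙ x) ∈ ⟨ p ⟩
    wx∈p = w[ I ] ∙ b , d , parabolic-∙ (longest∈ I) b∈ , d∈ ,
      trans (∙-congˡ x≈bpd) (trans (sym (assoc _ _ _)) (∙-congʳ (sym (assoc _ _ _))))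
    maximal : ∀ y → y ∈ ⟨ p ⟩ → y ≤ᴮ (w[ I ] ∙ x)
    maximal y (f , h , f∈ , h∈ , y≈fph) =
      -- From x = b q d follows y = f b⁻¹ x (d⁻¹ h), and `k` is the element of W_I with x (d⁻¹ h) =
      -- k x.
      let k , k∈ , _ , eq = intertwine-parabolic J→I (parabolic-∙ (parabolic-⁻¹ d∈) h∈) in
      ≤ᴮ-respˡ (sym (begin
        y                                        ≈⟨ y≈fph ⟩
        (f ∙ q) ∙ h                              ≈⟨ ∙-congʳ (∙-congˡ (cancelˡ (inverseˡ b) q)) ⟨
        (f ∙ (b ⁻¹ ∙ (b ∙ q))) ∙ h               ≈⟨ ∙-congʳ (∙-congˡ (∙-congˡ (cancelʳ (inverseʳ d) _))) ⟨
        (f ∙ (b ⁻¹ ∙ (((b ∙ q) ∙ d) ∙ d ⁻¹))) ∙ h ≈⟨ ∙-congʳ (∙-congˡ (∙-congˡ (∙-congʳ x≈bpd))) ⟨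
        (f ∙ (b ⁻¹ ∙ (x ∙ d ⁻¹))) ∙ h            ≈⟨ solve monoid ⟩
        (f ∙ b ⁻¹) ∙ (x ∙ (d ⁻¹ ∙ h))            ≈⟨ ∙-congˡ (∙-congˡ (cancelʳ (inverseˡ x) _)) ⟨
        (f ∙ b ⁻¹) ∙ (x ∙ (((d ⁻¹ ∙ h) ∙ x ⁻¹) ∙ x)) ≈⟨ ∙-congˡ (∙-congˡ (∙-congʳ eq)) ⟩
        (f ∙ b ⁻¹) ∙ (x ∙ ((x ⁻¹ ∙ k) ∙ x))      ≈⟨ ∙-congˡ (∙-congˡ (assoc _ _ _)) ⟩
        (f ∙ b ⁻¹) ∙ (x ∙ (x ⁻¹ ∙ (k ∙ x)))      ≈⟨ ∙-congˡ (cancelˡ (inverseʳ x) _) ⟩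
        (f ∙ b ⁻¹) ∙ (k ∙ x)                     ≈⟨ assoc _ _ _ ⟨
        ((f ∙ b ⁻¹) ∙ k) ∙ x                     ∎))
        (minimal⇒≤ᴮ I min (parabolic-∙ (parabolic-∙ f∈ (parabolic-⁻¹ b∈)) k∈))

  -- Atomic expressions

  involution-intertwines : w ∙ w ≈ ε → x ≈ (w ∙ y) ∙ w → x ∙ w ≈ w ∙ y × y ∙ w ≈ w ∙ x
  involution-intertwines ww≈ε x≈wyw =
    trans (∙-congʳ x≈wyw) (cancelʳ ww≈ε _) ,
    sym (trans (∙-congˡ (trans x≈wyw (assoc _ _ _))) (cancelˡ ww≈ε _))

  longest-intertwines : ∀ K {s} → s ∈ subset K →
    ∃[ t ] (t ∈ subset K × ι t ∙ w[ K ] ≈ w[ K ] ∙ ι s × ι s ∙ w[ K ] ≈ w[ K ] ∙ ι t)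
  longest-intertwines K s∈K = let t , t∈K , t≈ = longest-conjugate K s∈K in
    t , t∈K , involution-intertwines (longest-involutive K) t≈

  -- By `from`, x W_J lies in W_I x, so minimality under W_I is minimality in the whole double
  -- coset.
  record IsCoreMinimum (I J : Finitary) (x : Carrier) : Set (lsuc a ⊔ c ⊔ r) where
    field
      minimal : Minimal I x
      to      : Intertwines x (subset I) (subset J)
      from    : ∀ {j} → j ∈ subset J → ∃[ i ] (i ∈ subset I × ι i ∙ x ≈ x ∙ ι j)

  -- Splitting one atomic coset off a core coset.

  module CoreStep {I J : Finitary} {x : Carrier} (core : IsCoreMinimum I J x)
                  {s : S} (s-descent : ℓ (ι s ∙ x) < ℓ x) where
    open IsCoreMinimum core

    g : Carrier
    g = w[ I ] ∙ x

    ℓg : ℓ g ≡ ℓ w[ I ] + ℓ x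
    ℓg = minimal⇒additive minimal (longest∈ I)

    s∉I : ¬ (s ∈ subset I)
    s∉I s∈I = ℕ.<⇒≱ s-descent (minimal (parabolic-ι s∈I))

    -- Moving w_I across x turns g = w_I x into x w with w ∈ W_J and ℓ(w) ≤ ℓ(w_I).
    s-descent-g : ℓ (ι s ∙ g) < ℓ g
    s-descent-g = let w , _ , ℓw≤ , g≈xw = intertwine-parabolic to (longest∈ I) in begin-strict
      ℓ (ι s ∙ g)             ≡⟨ ℓ-cong (trans (∙-congˡ g≈xw) (sym (assoc _ _ _))) ⟩
      ℓ ((ι s ∙ x) ∙ w)       ≤⟨ ℓ-∙ _ _ ⟩
      ℓ (ι s ∙ x) + ℓ w       <⟨ ℕ.+-mono-<-≤ s-descent ℓw≤ ⟩
      ℓ x + ℓ w[ I ]          ≡⟨ ℕ.+-comm (ℓ x) _ ⟩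
      ℓ w[ I ] + ℓ x          ≡⟨ ℓg ⟨
      ℓ g                     ∎
      where open ℕ.≤-Reasoning

    K-set : Pred S a
    K-set i = i ∈ subset I ⊎ i ≡ s

    K-descent : ∀ {i} → i ∈ K-set → ℓ (ι i ∙ g) < ℓ g
    K-descent (inj₂ ≡.refl) = s-descent-g
    K-descent {i} (inj₁ i∈I) = begin-strict
      ℓ (ι i ∙ g)             ≡⟨ ℓ-cong (assoc _ _ _) ⟨
      ℓ ((ι i ∙ w[ I ]) ∙ x)  ≤⟨ ℓ-∙ _ _ ⟩
      ℓ (ι i ∙ w[ I ]) + ℓ x  <⟨ ℕ.+-monoˡ-< (ℓ x) (longest-descent I i∈I) ⟩
      ℓ w[ I ] + ℓ x          ≡⟨ ℓg ⟨
      ℓ g                     ∎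
      where open ℕ.≤-Reasoning

    K : Finitary
    K = descents⇒finitary K-descent (λ i → ∈-finitary? I i ⊎-dec (i ≟ₛ s))

    t-conjugate : ∃[ t ] (t ∈ subset K × ι t ≈ (w[ K ] ∙ ι s) ∙ w[ K ])
    t-conjugate = longest-conjugate K (inj₂ ≡.refl)

    t : S
    t = proj₁ t-conjugate

    t-intertwines : ι t ∙ w[ K ] ≈ w[ K ] ∙ ι s
    t-intertwines = proj₁ (involution-intertwines (longest-involutive K) (proj₂ (proj₂ t-conjugate)))

    I₁ : Finitary
    -- All members of `I₁` are descents of w_K, so the finiteness criterion applies again, now with
    -- w_K in the role of `g`.
    I₁ = descents⇒finitary {M = subset K ∖ t} (λ i∈ → longest-descent K (proj₁ i∈))
      (λ i → (∈-finitary? I i ⊎-dec (i ≟ₛ s)) ×-dec ¬? (i ≟ₛ t))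

    h : Carrier
    h = w[ K ] ∙ g

    ℓ-h : ℓ w[ K ] + ℓ h ≡ ℓ g
    ℓ-h = ℓ-parabolic∙ K-descent (longest∈ K)

    -- The element s w_I of W_K is longer than w_I, so ℓ(w_I) < ℓ(w_K), while ℓ(w_K) + ℓ(h) = ℓ(w_I)
    -- + ℓ(x).
    h-shorter : ℓ h < ℓ x
    h-shorter = ℕ.+-cancelˡ-< (ℓ w[ I ]) _ _ (begin-strict
      ℓ w[ I ] + ℓ h          <⟨ ℕ.+-monoˡ-< (ℓ h) (ℕ.<-≤-trans
        (ℕ.≰⇒> (λ le → s∉I (parabolic-descent s (longest∈ I) le)))
        (longest-maximal K (parabolic-∙ (parabolic-ι (inj₂ ≡.refl)) (parabolic-mono inj₁ (longest∈ I))))) ⟩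
      ℓ w[ K ] + ℓ h          ≡⟨ ℓ-h ⟩
      ℓ g                     ≡⟨ ℓg ⟩
      ℓ w[ I ] + ℓ x          ∎)
      where open ℕ.≤-Reasoning

    -- The element w h = (w w_K) g has length ℓ(g) - ℓ(w w_K), and w w_K is no longer than w_K.
    h-minimal : Minimal I₁ h
    h-minimal {w} w∈ = ℕ.+-cancelˡ-≤ (ℓ w[ K ]) _ _ (begin
      ℓ w[ K ] + ℓ h                          ≡⟨ ℓ-h ⟩
      ℓ g                                     ≡⟨ ℓ-parabolic∙ K-descent wwK∈ ⟨
      ℓ (w ∙ w[ K ]) + ℓ ((w ∙ w[ K ]) ∙ g)   ≤⟨ ℕ.+-monoˡ-≤ _ (longest-maximal K wwK∈) ⟩
      ℓ w[ K ] + ℓ ((w ∙ w[ K ]) ∙ g)         ≡⟨ ≡.cong (ℓ w[ K ] +_) (ℓ-cong (assoc _ _ _)) ⟩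
      ℓ w[ K ] + ℓ (w ∙ h)                    ∎)
      where
      open ℕ.≤-Reasoning
      wwK∈ : (w ∙ w[ K ]) ∈ Parabolic (subset K)
      wwK∈ = parabolic-∙ (parabolic-mono proj₁ w∈) (longest∈ K)

    -- A generator crosses h = w_K w_I x in three moves. Crossing w_K takes only `t` to `s`, so k ≠
    -- t lands in `I`, where w_I permutes and `x` leads to `J`.
    h-to : Intertwines h (subset I₁) (subset J)
    h-to {k} (k∈K , k≢t) = let i , i∈K , _ , kK≈Ki = longest-intertwines K k∈K in go i∈K kK≈Ki
      where
      go : ∀ {i} → i ∈ subset K → ι k ∙ w[ K ] ≈ w[ K ] ∙ ι i →
        ∃[ j ] (j ∈ subset J × ι k ∙ h ≈ h ∙ ι j)
      go (inj₁ i∈I) kK≈Ki =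
        let i′ , i′∈I , _ , iI≈Ii′ = longest-intertwines I i∈I
            j , j∈J , i′x≈xj = to i′∈I
        in j , j∈J , intertwine-∙ kK≈Ki (intertwine-∙ iI≈Ii′ i′x≈xj)
      go (inj₂ ≡.refl) kK≈Ks =
        contradiction (ι-injective (∙-cancelʳ w[ K ] _ _ (trans kK≈Ks (sym t-intertwines)))) k≢t

    h-from : ∀ {j} → j ∈ subset J → ∃[ k ] (k ∈ subset I₁ × ι k ∙ h ≈ h ∙ ι j)
    h-from j∈J =
      let i′ , i′∈I , i′x≈xj = from j∈J
          i , i∈I , iI≈Ii′ , _ = longest-intertwines I i′∈I
          k , k∈K , kK≈Ki , _ = longest-intertwines K (inj₁ i∈I)
      in k , (k∈K , k≢t i∈I kK≈Ki) , intertwine-∙ kK≈Ki (intertwine-∙ iI≈Ii′ i′x≈xj)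
      where
      k≢t : ∀ {i k} → i ∈ subset I → ι k ∙ w[ K ] ≈ w[ K ] ∙ ι i → k ≢ t
      k≢t i∈I kK≈Ki ≡.refl = s∉I (≡.subst (_∈ subset I)
        (ι-injective (∙-cancelˡ w[ K ] _ _ (trans (sym kK≈Ki) t-intertwines))) i∈I)

    h-core : IsCoreMinimum I₁ J h
    h-core = record { minimal = h-minimal ; to = h-to ; from = h-from }

    atomicVia : AtomicVia {I} {I₁} K (coset-of w[ K ])
    atomicVia = record
      { s   = s
      ; t   = t
      ; s∈M = inj₂ ≡.refl
      ; t≈  = proj₂ (proj₂ t-conjugate)
      ; I≐  = (λ i∈I → inj₁ i∈I , λ { ≡.refl → s∉I i∈I })
            , λ { (inj₁ i∈I , _) → i∈I ; (inj₂ i≡s , i≢s) → contradiction i≡s i≢s }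
      ; J≐  = (λ p → p) , λ p → p
      ; w∈p = ε , ε , parabolic-ε , parabolic-ε , sym (trans (identityʳ _) (identityˡ _))
      }

    -- The coset lies in W_K, whose Bruhat maximum is w_K by `minimal⇒≤ᴮ` at the identity.
    atomic-maximum : IsMaximum {I} {I₁} (coset-of w[ K ]) w[ K ]
    atomic-maximum = AtomicVia.w∈p atomicVia , λ { y (b , d , b∈ , d∈ , y≈) →
      ≤ᴮ-respˡ (trans (identityʳ _) (sym y≈)) (≤ᴮ-respʳ (identityʳ _)
        (minimal⇒≤ᴮ K (λ _ → ℕ.≤-trans (ℕ.≤-reflexive ℓ-ε) z≤n)
          (parabolic-∙ (parabolic-∙ (parabolic-mono inj₁ b∈) (longest∈ K)) (parabolic-mono proj₁ d∈)))) }

  -- Assembling the reduced expression.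

  product-step : ∀ {I J} K I₁ {I⊆K : subset I ⊆ᵖ subset K} {I₁⊆K : subset I₁ ⊆ᵖ subset K} (e : Expression I₁ J) →
    product (step {I} K I₁ I⊆K I₁⊆K e) ≈ (w[ K ] ∙ w[ I₁ ] ⁻¹) ∙ product e
  -- A final step omits w_{I₁}⁻¹; since the trivial remainder is read as w_{I₁}, the general formula
  -- still holds after cancellation.
  product-step K I₁ (trivial _)      = sym (cancelʳ (inverseˡ w[ I₁ ]) _)
  product-step K I₁ (step _ _ _ _ _) = refl

  expressionLength-step : ∀ {I J} K I₁ {I⊆K : subset I ⊆ᵖ subset K} {I₁⊆K : subset I₁ ⊆ᵖ subset K} (e : Expression I₁ J) →
    expressionLength (step {I} K I₁ I⊆K I₁⊆K e) ≡ (ℓ[ K ] -ℤ ℓ[ I₁ ]) +ℤ expressionLength e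
  expressionLength-step K I₁ (step _ _ _ _ _) = ≡.refl
  expressionLength-step K I₁ (trivial _)      = ≡.sym (minus-plus ℓ[ K ] ℓ[ I₁ ])

  -- The target `w[ I ] ∙ x` is the coset's maximum by `minimal⇒maximum`; naming the element frees
  -- the induction from coset representatives.
  AtomicExpressionFor : Finitary → Finitary → Carrier → Set _
  AtomicExpressionFor I J x = ∃[ e ]
    (product {I} {J} e ≈ w[ I ] ∙ x × expressionLength e ≡ pos (ℓ w[ I ] + ℓ x) × IsAtomicExpression e)

  -- At the identity the relations i x = x j read i = j, so I = J.
  trivial-expression : ∀ {I J x} → x ≈ ε → IsCoreMinimum I J x → AtomicExpressionFor I J x
  trivial-expression {I} {J} {x} x≈ε core =
    trivial ((λ i∈I → let j , j∈J , ix≈xj = to i∈I in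
                      ≡.subst (_∈ subset J) (≡.sym (commutes ix≈xj)) j∈J)
           , (λ j∈J → let i , i∈I , ix≈xj = from j∈J in
                      ≡.subst (_∈ subset I) (commutes ix≈xj) i∈I))
    , sym (trans (∙-congˡ x≈ε) (identityʳ _))
    , ≡.cong pos (≡.sym (≡.trans (≡.cong (ℓ w[ I ] +_) (≡.trans (ℓ-cong x≈ε) ℓ-ε)) (ℕ.+-identityʳ _)))
    , tt
    where
    open IsCoreMinimum core
    commutes : ∀ {i j} → ι i ∙ x ≈ x ∙ ι j → i ≡ j
    commutes p = ι-injective (trans (trans (sym (identityʳ _)) (∙-congˡ (sym x≈ε)))
      (trans p (trans (∙-congʳ x≈ε) (identityˡ _))))

  -- The factor w_{I₁}⁻¹ cancels the leading w_{I₁} of the remaining product, leaving w_K h = g;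
  -- lengths telescope likewise.
  step-expression : ∀ {I J x} (core : IsCoreMinimum I J x) {s} (s-descent : ℓ (ι s ∙ x) < ℓ x) →
    let open CoreStep core s-descent in
    AtomicExpressionFor I₁ J h → AtomicExpressionFor I J x
  step-expression {I} {J} {x} core s-descent (e , product≈ , length≡ , atomic) =
    step K I₁ inj₁ proj₁ e
    , trans (product-step K I₁ e) product-g
    , ≡.trans (expressionLength-step K I₁ e) length-g
    , (coset-of w[ K ] , (K , atomicVia) , w[ K ] , atomic-maximum , refl , ≡.refl)
    , atomic
    where
    open CoreStep core s-descent
    product-g : (w[ K ] ∙ w[ I₁ ] ⁻¹) ∙ product e ≈ g
    product-g = begin
      (w[ K ] ∙ w[ I₁ ] ⁻¹) ∙ product e          ≈⟨ ∙-congˡ product≈ ⟩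
      (w[ K ] ∙ w[ I₁ ] ⁻¹) ∙ (w[ I₁ ] ∙ h)      ≈⟨ cancelᶜ (inverseˡ w[ I₁ ]) _ _ ⟩
      w[ K ] ∙ h                                 ≈⟨ longest-cancel K g ⟩
      g                                          ∎
      where open ≈-Reasoning setoid
    length-g : (ℓ[ K ] -ℤ ℓ[ I₁ ]) +ℤ expressionLength e ≡ pos (ℓ w[ I ] + ℓ x)
    length-g = begin
      (ℓ[ K ] -ℤ ℓ[ I₁ ]) +ℤ expressionLength e           ≡⟨ ≡.cong ((ℓ[ K ] -ℤ ℓ[ I₁ ]) +ℤ_) length≡ ⟩
      (ℓ[ K ] -ℤ ℓ[ I₁ ]) +ℤ (ℓ[ I₁ ] +ℤ pos (ℓ h))       ≡⟨ ℤ.+-assoc (ℓ[ K ] -ℤ ℓ[ I₁ ]) ℓ[ I₁ ] (pos (ℓ h)) ⟨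
      ((ℓ[ K ] -ℤ ℓ[ I₁ ]) +ℤ ℓ[ I₁ ]) +ℤ pos (ℓ h)       ≡⟨ ≡.cong (_+ℤ pos (ℓ h)) (minus-plus ℓ[ K ] ℓ[ I₁ ]) ⟩
      ℓ[ K ] +ℤ pos (ℓ h)                                 ≡⟨ ≡.cong pos (≡.trans ℓ-h ℓg) ⟩
      pos (ℓ w[ I ] + ℓ x)                                ∎
      where open ≡.≡-Reasoning

  descent-exists : ∀ x → x ≈ ε ⊎ ∃[ s ] ℓ (ι s ∙ x) < ℓ x
  descent-exists x with ℓ-attained x
  ... | []    , ε≈x  , _   = inj₁ (sym ε≈x)
  ... | s ∷ u , su≈x , len = inj₂ (s , ≡.subst (ℓ (ι s ∙ x) <_) len
    (s≤s (ℓ-minimal _ u (trans (sym (ιι-cancel s _)) (∙-congˡ su≈x)))))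

  -- The bound `n` drives the recursion, as `h` is shorter than `x` without being a subterm.
  atomic-expression : ∀ n {I J x} → ℓ x < n → IsCoreMinimum I J x → AtomicExpressionFor I J x
  atomic-expression (suc n) {I} {J} {x} ℓx<n core = go (descent-exists x)
    where
    go : x ≈ ε ⊎ ∃[ s ] ℓ (ι s ∙ x) < ℓ x → AtomicExpressionFor I J x
    go (inj₁ x≈ε)             = trivial-expression x≈ε core
    go (inj₂ (_ , s-descent)) = step-expression core s-descent
      (atomic-expression n (ℕ.<-≤-trans h-shorter (s≤s⁻¹ ℓx<n)) h-core)
      where open CoreStep core s-descent

  core⇒coreMinimum : ∀ {I J} (p : DoubleCoset I J) {x} → IsMinimum p x →
    Simple (subset I) ≐ Conjugate x (Simple (subset J)) → IsCoreMinimum I J x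
  core⇒coreMinimum p {x} ((b , d , b∈ , d∈ , x≈bpd) , min) (I⊆ , ⊆I) = record
    { minimal = λ {w} w∈ → ≤ᴮ⇒ℓ≤ (min _ (w ∙ b , d , parabolic-∙ w∈ b∈ , d∈ ,
        trans (∙-congˡ x≈bpd) (trans (sym (assoc _ _ _)) (∙-congʳ (sym (assoc _ _ _))))))
    ; to = λ {i} i∈I → let v , (j , j∈J , v≈j) , i≈xvx⁻¹ = I⊆ (i , i∈I , refl) in
        j , j∈J , trans (∙-congʳ i≈xvx⁻¹) (trans (cancelʳ (inverseˡ x) _) (∙-congˡ v≈j))
    ; from = λ {j} j∈J → let i , i∈I , xjx⁻¹≈i = ⊆I (ι j , (j , j∈J , refl) , refl) in
        i , i∈I , trans (∙-congʳ (sym xjx⁻¹≈i)) (cancelʳ (inverseˡ x) _)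
    }

theorem1p8 : ∀ {a c r} (C : CoxeterSystem a c r) (L : LengthFunction C) →
    let open Coxeter C L in
    (I J : Finitary) (p : DoubleCoset I J) → IsCore p →
    ∃[ e ] (IsReducedExpression {I} {J} e p × IsAtomicExpression e)
theorem1p8 C L I J p (x , min , I≐xJ) =
  let e , prod , len , atomic = atomic-expression (suc (ℓ x)) ℕ.≤-refl core
  in e , (w[ I ] ∙ x
         , minimal⇒maximum p minimal J→I (proj₁ min)
         , sym prod
         , ≡.trans (≡.cong pos (minimal⇒additive minimal (longest∈ I))) (≡.sym len))
       , atomic
  where
  open CoxeterSystem C
  open LengthFunction L
  open Coxeter C L
  open CoxeterTheory C L
  open Group W using (sym)
  core : IsCoreMinimum I J x
  core = core⇒coreMinimum p min I≐xJ
  open IsCoreMinimum core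
  J→I : Intertwines (x ⁻¹) (subset J) (subset I)
  J→I j∈J = let i , i∈I , ix≈xj = from j∈J in i , i∈I , swap-inverse ix≈xj
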